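{- Let $D, r \ge 2$ be integers. There exists a constant $C = C(D, r)$ such that for all sufficiently large $n$ there exists an $r$-uniform hypergraph with at most $$Cn^{r-1/D}(\log n)^{2/D}(\log\log n)^{2r+1}$$ edges which is universal for the class $\mathcal{H}^{(r)}(n, D)$ of $D$-degenerate $r$-uniform hypergraphs on $n$ vertices.
   Context: An $r$-graph is an $r$-uniform hypergraph. An $r$-graph $H$ is $D$-degenerate if there is an ordering $v_1, \dots, v_n$ of its vertices such that for every $i$, at most $D$ edges of $H$ contain $v_i$ and are contained entirely in $\{v_1, \dots, v_i\}$. $\mathcal{H}^{(r)}(n,D)$ denotes the class of $D$-degenerate $r$-graphs on $n$ vertices. An $r$-graph $\Gamma$ is universal for a class $\mathcal{H}$ if $\Gamma$ contains a copy of every $H \in \mathcal{H}$ as a (not necessarily induced) subgraph. Logarithms are base 2. -}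

module Defs where

open import Data.Nat using (ℕ; zero; suc; _+_; _*_; _∸_; _^_; _≤_; _≤ᵇ_)
open import Data.Bool using (Bool; true; false; if_then_else_; _∧_)
open import Data.Fin using (Fin; toℕ)
import Data.Fin as F
open import Data.Fin.Subset using (Subset; ⁅_⁆; _∪_; ⊥; ∣_∣)
open import Data.Fin.Subset.Properties using (_∈?_; _⊆?_)
open import Data.Fin.Permutation using (Permutation′; _⟨$⟩ʳ_; _⟨$⟩ˡ_)
open import Data.Vec using (Vec; []; _∷_; tabulate)
open import Data.List using (List; []; _∷_; _++_; map)
open import Data.Product using (Σ; ∃; _×_)
open import Function using (_∘_)
open import Function.Definitions using (Injective)
open import Relation.Binary.PropositionalEquality using (_≡_)
open import Relation.Nullary using (does)

Hypergraph : ℕ → Set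
Hypergraph m = Subset m → Bool

Uniform : (r : ℕ) {m : ℕ} → Hypergraph m → Set
Uniform r {m} E = (e : Subset m) → E e ≡ true → ∣ e ∣ ≡ r

allSubsets : (m : ℕ) → List (Subset m)
allSubsets zero = [] ∷ []
allSubsets (suc m) = map (true ∷_) (allSubsets m) ++ map (false ∷_) (allSubsets m)

countB : {A : Set} → (A → Bool) → List A → ℕ
countB p [] = 0
countB p (x ∷ xs) = (if p x then 1 else 0) + countB p xs

edgeCount : {m : ℕ} → Hypergraph m → ℕ
edgeCount {m} E = countB E (allSubsets m)

-- D-degenerate: there is an ordering v_i = π i of the vertices such that for every i,
-- at most D edges contain v_i and are contained in {v_j : j ≤ i}.
prefixSet : {n : ℕ} → Permutation′ n → Fin n → Subset n
prefixSet π i = tabulate (λ x → toℕ (π ⟨$⟩ˡ x) ≤ᵇ toℕ i)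

backDegree : {n : ℕ} → Hypergraph n → Permutation′ n → Fin n → ℕ
backDegree {n} E π i =
  countB (λ e → E e ∧ does ((π ⟨$⟩ʳ i) ∈? e) ∧ does (e ⊆? prefixSet π i)) (allSubsets n)

Degenerate : (D : ℕ) {n : ℕ} → Hypergraph n → Set
Degenerate D {n} E = Σ (Permutation′ n) λ π → (i : Fin n) → backDegree E π i ≤ D

image : {n m : ℕ} → (Fin n → Fin m) → Subset n → Subset m
image {zero} f [] = ⊥
image {suc n} f (b ∷ e) = (if b then ⁅ f F.zero ⁆ else ⊥) ∪ image (f ∘ F.suc) e

_⊑_ : {n m : ℕ} → Hypergraph n → Hypergraph m → Set
_⊑_ {n} {m} H Γ = Σ (Fin n → Fin m) λ f →
  Injective _≡_ _≡_ f × ((e : Subset n) → H e ≡ true → Γ (image f e) ≡ true)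

Universal : (r D n : ℕ) {m : ℕ} → Hypergraph m → Set
Universal r D n Γ = (H : Hypergraph n) → Uniform r H → Degenerate D H → H ⊑ Γ

{-# OPTIONS --safe #-}
-- Let n ≈ 2 ^ (D k₀ + 2 b) with 2 ^ b ≈ log n.  The host has levels e = 0, …, k₀ of about 2 ^ (D e + 2 b)
-- vertices each.  A link is an (r − 1)-tuple c of host vertices; if its first entry has level k₀ − τ,
-- a vertex v of level e accepts c with probability 2 ^ −(e ∸ (D τ ∸ b)), independently, and the edges
-- are the sets {v} ∪ c with c accepted by v.  Counting accepted pairs gives O(W ^ r / 2 ^ k₀) edges,
-- where W = 2 ^ (D k₀ + 2 b) ≤ n, and (W ^ r / 2 ^ k₀) ^ D = W ^ (r D − 1) · 2 ^ (2 b).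
--
-- A D-degenerate H is embedded greedily along its ordering.  A vertex whose forward degree (counted
-- along first entries of links) is about 2 ^ (D (k₀ − e)) may use the levels ≤ e, and it takes an unused
-- vertex accepting all its at most D back links in the highest possible level.  The number of vertices
-- that fail at level e is O(2 ^ (D e + 2 b)): otherwise, for some j, many of them have j as the largest
-- τ of a link that is not accepted automatically.  Such links lie in at most 2 ^ (D j) of the link sets,
-- so one finds 2 ^ (D e ∸ (D j ∸ b)) pairwise disjoint link sets.  A random vertex accepts one of them
-- with probability at least 1/2, and so, by a union bound over all such families, every family is
-- accepted by more vertices of level e than are ever used there.
module Submission where

open import Defs
open import Data.Bool using (Bool; true; false; if_then_else_; not; _∧_)
import Data.Bool.Properties as Bool
open import Data.Empty using (⊥)
open import Data.Fin using (Fin; zero; suc; toℕ; fromℕ<; funToFin; finToFun; combine; quotient; _↑ˡ_; _↑ʳ_)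
open import Data.Fin.Permutation using (Permutation′; _⟨$⟩ʳ_; _⟨$⟩ˡ_; inverseˡ; inverseʳ)
import Data.Fin.Properties as Fin
open import Data.Fin.Subset as Subset using (Subset; ⁅_⁆; _∪_; ∣_∣; _-_; ⊤) renaming (_∈_ to _∈ₛ_; _∉_ to _∉ₛ_; _⊆_ to _⊆ₛ_)
open import Data.Fin.Subset.Properties using (∉⊥; x∈⁅x⁆; x∈⁅y⁆⇒x≡y; x∈p∪q⁻; x∈p∪q⁺; ∈⊤; ⊆-antisym; ∣⊥∣≡0; p─q⊆p; p─⊥≡p; x∈p∧x≢y⇒x∈p-y; ∪-identityˡ; _⊆?_) renaming (_∈?_ to _∈ₛ?_)
open import Data.List using (List; []; _∷_; _++_; map; concatMap; length; allFin; upTo; filter; tabulate; replicate; lookup; cartesianProduct)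
open import Data.List.Membership.DecPropositional using (_∈?_)
open import Data.List.Membership.Propositional using (_∈_; lose)
open import Data.List.Membership.Propositional.Properties using (∈-allFin; ∈-map⁺; ∈-map⁻; ∈-upTo⁺; ∈-upTo⁻; ∈-filter⁺; ∈-filter⁻; ∈-++⁺ˡ; ∈-++⁺ʳ; ∈-++⁻; ∈-concatMap⁺; ∈-cartesianProduct⁺; ∈-lookup)
open import Data.List.Properties using (map-tabulate; tabulate-lookup; map-cong-local; length-tabulate; length-map; length-++; length-replicate; length-upTo; length-filter)
open import Data.List.Relation.Unary.All as All using (All; []; _∷_; all?)
import Data.List.Relation.Unary.All.Properties as All
open import Data.List.Relation.Unary.AllPairs as AllPairs using (AllPairs; []; _∷_)
import Data.List.Relation.Unary.AllPairs.Properties as AllPairs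
open import Data.List.Relation.Unary.Any as Any using (Any; here; there; any?)
open import Data.Nat hiding (∣_-_∣)
open import Data.Nat.DivMod using (_/_; _%_; m≡m%n+[m/n]*n; m%n<n; m/n*n≤m; m/n≤m; /-monoˡ-≤; m*n/n≡m)
open import Data.Nat.Induction using (<-rec)
open import Data.Nat.Logarithm using (⌈log₂_⌉; ⌈log₂⌉-mono-≤; ⌈log₂2^n⌉≡n; ⌈log₂⌈n/2⌉⌉≡⌈log₂n⌉∸1)
open import Data.Nat.Properties
open import Data.Nat.Tactic.RingSolver using (solve-∀)
open import Data.Product using (Σ; ∃; _×_; _,_; proj₁; proj₂)
open import Data.Sum using (_⊎_; inj₁; inj₂)
open import Data.Vec using ([]; _∷_; here; there)
open import Data.Vec.Functional using () renaming (_∷_ to _◂_)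
open import Data.Vec.Properties using (≡-dec; ∷-injectiveˡ; ∷-injectiveʳ; lookup∘tabulate; []=⇒lookup; lookup⇒[]=)
open import Function using (_∘_; id; const)
open import Function.Bundles using (Equivalence)
open import Function.Definitions using (Injective)
open import Relation.Binary using (DecidableEquality)
open import Relation.Binary.PropositionalEquality
open import Relation.Nullary
open import Relation.Nullary.Decidable using (_×-dec_; _→-dec_; dec-true; dec-false; decidable-stable)

-- In a host of uniform density a vertex of large forward degree may lie in almost all link sets,
-- and then no large disjoint family exists. The levels remove this obstacle: a vertex placed in
-- level `k₀ − τ ≥ 1` has forward degree at most `2 ^ (D τ)`, so links that may be shared by many
-- are exactly those accepted more easily. If one of `D` links has `τ = j` and is not automatic, all
-- are accepted in level `e` with probability at least `2 ^ −K`, where `K = D e − (D j ∸ b)`. The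
-- `2 ^ K` disjoint sets wanted, times the conflict degree `D 2 ^ (D j)`, give at most
-- `D 2 ^ (D e + b)`, whatever `j` is. The shift by `b` serves the edge count. All levels contribute
-- equally to the sum of `2 ^ (D τ)`, which costs a factor `k₀ + 1 ≤ 2 ^ b`, and the shift divides
-- it out. The price is a factor `2 ^ b` in the number of failures; the choice of `j` costs another,
-- hence `2 b` in the level sizes. The same `2 ^ (2 b)` exceeds the `O(log n)` per link set in the
-- union bound. Probability is counting over a finite list of labellings. Labels are fixed vertex by
-- vertex, which also bounds the links accepted by each single vertex.

private variable
  A B P Q : Set

-- Finite sums

𝟙 : Dec P → ℕ
𝟙 d = if does d then 1 else 0

𝟙-mono : (p : Dec P) (q : Dec Q) → (P → Q) → 𝟙 p ≤ 𝟙 q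
𝟙-mono (no _)  q       f = z≤n
𝟙-mono (yes p) (yes _) f = ≤-refl
𝟙-mono (yes p) (no ¬q) f = contradiction (f p) ¬q

𝟙-true : (p : Dec P) → P → 𝟙 p ≡ 1
𝟙-true (yes _) _ = refl
𝟙-true (no ¬p) p = contradiction p ¬p

𝟙-false : (p : Dec P) → ¬ P → 𝟙 p ≡ 0
𝟙-false (yes p) ¬p = contradiction p ¬p
𝟙-false (no _)  _  = refl

𝟙-≤ : (p : Dec P) {k : ℕ} → (P → 1 ≤ k) → 𝟙 p ≤ k
𝟙-≤ (yes p) f = f p
𝟙-≤ (no _)  f = z≤n

𝟙-cong : (p : Dec P) (q : Dec Q) → (P → Q) → (Q → P) → 𝟙 p ≡ 𝟙 q
𝟙-cong p q f g = ≤-antisym (𝟙-mono p q f) (𝟙-mono q p g)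

𝟙-× : (p : Dec P) (q : Dec Q) → 𝟙 (p ×-dec q) ≡ 𝟙 p * 𝟙 q
𝟙-× (yes _) (yes _) = refl
𝟙-× (yes _) (no _)  = refl
𝟙-× (no _)  _       = refl

𝟙-¬ : (p : Dec P) → 𝟙 (¬? p) + 𝟙 p ≡ 1
𝟙-¬ (yes _) = refl
𝟙-¬ (no _)  = refl

∑ : List A → (A → ℕ) → ℕ
∑ []       f = 0
∑ (x ∷ xs) f = f x + ∑ xs f

∑-mono-∈ : (xs : List A) {f g : A → ℕ} → (∀ x → x ∈ xs → f x ≤ g x) → ∑ xs f ≤ ∑ xs g
∑-mono-∈ []       h = z≤n
∑-mono-∈ (x ∷ xs) h = +-mono-≤ (h x (here refl)) (∑-mono-∈ xs (λ y → h y ∘ there))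

∑-mono : (xs : List A) {f g : A → ℕ} → (∀ x → f x ≤ g x) → ∑ xs f ≤ ∑ xs g
∑-mono xs h = ∑-mono-∈ xs (λ x _ → h x)

∑-cong : (xs : List A) {f g : A → ℕ} → (∀ x → f x ≡ g x) → ∑ xs f ≡ ∑ xs g
∑-cong []       h = refl
∑-cong (x ∷ xs) h = cong₂ _+_ (h x) (∑-cong xs h)

∑-+ : (xs : List A) (f g : A → ℕ) → ∑ xs (λ x → f x + g x) ≡ ∑ xs f + ∑ xs g
∑-+ []       f g = refl
∑-+ (x ∷ xs) f g rewrite ∑-+ xs f g = interchange (f x) (g x) (∑ xs f) (∑ xs g)
  where
  interchange : ∀ a b c d → a + b + (c + d) ≡ a + c + (b + d)
  interchange = solve-∀

∑-*ˡ : (xs : List A) (c : ℕ) (f : A → ℕ) → ∑ xs (λ x → c * f x) ≡ c * ∑ xs f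
∑-*ˡ []       c f = sym (*-zeroʳ c)
∑-*ˡ (x ∷ xs) c f rewrite ∑-*ˡ xs c f = sym (*-distribˡ-+ c (f x) (∑ xs f))

∑-*ʳ : (xs : List A) (f : A → ℕ) (c : ℕ) → ∑ xs (λ x → f x * c) ≡ ∑ xs f * c
∑-*ʳ xs f c = trans (∑-cong xs (λ x → *-comm (f x) c)) (trans (∑-*ˡ xs c f) (*-comm c (∑ xs f)))

∑-const : (xs : List A) (c : ℕ) → ∑ xs (const c) ≡ length xs * c
∑-const []       c = refl
∑-const (x ∷ xs) c = cong (c +_) (∑-const xs c)

∑-≤ : (xs : List A) {f : A → ℕ} {c : ℕ} → (∀ x → x ∈ xs → f x ≤ c) → ∑ xs f ≤ length xs * c
∑-≤ xs {c = c} h = ≤-trans (∑-mono-∈ xs h) (≤-reflexive (∑-const xs c))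

∑-swap : (xs : List A) (ys : List B) (f : A → B → ℕ) →
         ∑ xs (λ x → ∑ ys (f x)) ≡ ∑ ys (λ y → ∑ xs (λ x → f x y))
∑-swap []       ys f = sym (trans (∑-const ys 0) (*-zeroʳ (length ys)))
∑-swap (x ∷ xs) ys f rewrite ∑-swap xs ys f = sym (∑-+ ys (f x) (λ y → ∑ xs (λ x → f x y)))

∑-++ : (xs ys : List A) (f : A → ℕ) → ∑ (xs ++ ys) f ≡ ∑ xs f + ∑ ys f
∑-++ []       ys f = refl
∑-++ (x ∷ xs) ys f rewrite ∑-++ xs ys f = sym (+-assoc (f x) (∑ xs f) (∑ ys f))

∑-map : (g : A → B) (xs : List A) (f : B → ℕ) → ∑ (map g xs) f ≡ ∑ xs (f ∘ g)
∑-map g []       f = refl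
∑-map g (x ∷ xs) f = cong (f (g x) +_) (∑-map g xs f)

∑-concatMap : (g : A → List B) (xs : List A) (f : B → ℕ) →
              ∑ (concatMap g xs) f ≡ ∑ xs (λ x → ∑ (g x) f)
∑-concatMap g []       f = refl
∑-concatMap g (x ∷ xs) f = trans (∑-++ (g x) (concatMap g xs) f) (cong (∑ (g x) f +_) (∑-concatMap g xs f))

∑-replicate : (k : ℕ) (x : A) (f : A → ℕ) → ∑ (replicate k x) f ≡ k * f x
∑-replicate zero    x f = refl
∑-replicate (suc k) x f = cong (f x +_) (∑-replicate k x f)

∑-∈ : {xs : List A} {x : A} (f : A → ℕ) → x ∈ xs → f x ≤ ∑ xs f
∑-∈ f (here refl)            = m≤m+n _ _
∑-∈ f (there {x = y} x∈xs) = ≤-trans (∑-∈ f x∈xs) (m≤n+m _ (f y))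

∑-length : (xs : List A) → ∑ xs (const 1) ≡ length xs
∑-length xs = trans (∑-const xs 1) (*-identityʳ (length xs))

∑-tabulate : ∀ {n} (g : Fin n → A) (f : A → ℕ) → ∑ (tabulate g) f ≡ ∑ (allFin n) (f ∘ g)
∑-tabulate {n = n} g f = trans (cong (λ l → ∑ l f) (sym (map-tabulate id g))) (∑-map g (allFin n) f)

∑-allFin-suc : ∀ {n} (f : Fin (suc n) → ℕ) → ∑ (allFin (suc n)) f ≡ f zero + ∑ (allFin n) (f ∘ suc)
∑-allFin-suc f = cong (f zero +_) (∑-tabulate suc f)

∑-average : (xs : List A) (f : A → ℕ) (q : ℕ) → 0 < length xs → ∑ xs f ≤ length xs * q →
            ∃ λ x → f x ≤ q
∑-average (x ∷ xs) f q _ h with f x ≤? q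
... | yes p = x , p
... | no ¬p with xs
...   | []     = x , ≤-trans (≤-trans (m≤m+n (f x) 0) h) (≤-reflexive (+-identityʳ q))
...   | y ∷ ys = ∑-average (y ∷ ys) f q z<s
                   (+-cancelˡ-≤ q _ _ (≤-trans (+-monoˡ-≤ _ (<⇒≤ (≰⇒> ¬p))) h))

-- A surjection in counting form: `g` covers `P` from `Q`, and `once` states that `xs` has no
-- repeated entry, so each `b` is charged at most once after the double sum is swapped.
count-cover : (xs : List A) (ys : List B) {P : A → Set} {Q : B → Set}
  (P? : ∀ a → Dec (P a)) (Q? : ∀ b → Dec (Q b)) (g : B → A) (_≟ᴬ_ : DecidableEquality A) →
  (∀ a → ∑ xs (λ a′ → 𝟙 (a ≟ᴬ a′)) ≤ 1) →
  (∀ a → P a → ∃ λ b → b ∈ ys × Q b × g b ≡ a) →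
  ∑ xs (𝟙 ∘ P?) ≤ ∑ ys (𝟙 ∘ Q?)
count-cover xs ys P? Q? g _≟ᴬ_ once cover = begin
  ∑ xs (𝟙 ∘ P?)
    ≤⟨ ∑-mono xs (λ a → 𝟙-≤ (P? a) (λ p → let (b , b∈ , q , eq) = cover a p in
         ≤-trans (≤-reflexive (sym (cong₂ _*_ (𝟙-true (Q? b) q) (𝟙-true (g b ≟ᴬ a) eq))))
                 (∑-∈ (λ b → 𝟙 (Q? b) * 𝟙 (g b ≟ᴬ a)) b∈))) ⟩
  ∑ xs (λ a → ∑ ys (λ b → 𝟙 (Q? b) * 𝟙 (g b ≟ᴬ a)))
    ≡⟨ ∑-swap xs ys _ ⟩
  ∑ ys (λ b → ∑ xs (λ a → 𝟙 (Q? b) * 𝟙 (g b ≟ᴬ a)))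
    ≡⟨ ∑-cong ys (λ b → ∑-*ˡ xs (𝟙 (Q? b)) _) ⟩
  ∑ ys (λ b → 𝟙 (Q? b) * ∑ xs (λ a → 𝟙 (g b ≟ᴬ a)))
    ≤⟨ ∑-mono ys (λ b → ≤-trans (*-monoʳ-≤ (𝟙 (Q? b)) (once (g b))) (≤-reflexive (*-identityʳ _))) ⟩
  ∑ ys (𝟙 ∘ Q?) ∎
  where open ≤-Reasoning

allFin-once : ∀ n (i : Fin n) → ∑ (allFin n) (λ j → 𝟙 (i Fin.≟ j)) ≤ 1
allFin-once (suc n) zero = ≤-reflexive (trans (∑-allFin-suc {n} (λ j → 𝟙 (zero Fin.≟ j)))
  (cong suc (trans (∑-cong (allFin n) (λ j → 𝟙-false (zero Fin.≟ suc j) λ ()))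
                   (trans (∑-const (allFin n) 0) (*-zeroʳ (length (allFin n)))))))
allFin-once (suc n) (suc i) = ≤-trans (≤-reflexive (trans (∑-allFin-suc {n} (λ j → 𝟙 (suc i Fin.≟ j)))
  (∑-cong (allFin n) (λ j → 𝟙-cong (suc i Fin.≟ suc j) (i Fin.≟ j) Fin.suc-injective (cong suc))))) (allFin-once n i)

^-distribʳ-* : ∀ x a b → (a * b) ^ x ≡ a ^ x * b ^ x
^-distribʳ-* zero    a b = refl
^-distribʳ-* (suc x) a b rewrite ^-distribʳ-* x a b = regroup a b (a ^ x) (b ^ x)
  where
  regroup : ∀ a b c d → a * b * (c * d) ≡ a * c * (b * d)
  regroup = solve-∀

-- Independence in the space of random labellings

lists : List A → ℕ → List (List A)
lists xs zero    = [] ∷ []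
lists xs (suc n) = concatMap (λ x → map (x ∷_) (lists xs n)) xs

length-lists : (xs : List A) (n : ℕ) → length (lists xs n) ≡ length xs ^ n
length-lists xs zero    = refl
length-lists xs (suc n) = begin
  length (lists xs (suc n))                                   ≡⟨ sym (∑-length (lists xs (suc n))) ⟩
  ∑ (lists xs (suc n)) (const 1)                              ≡⟨ ∑-concatMap (λ x → map (x ∷_) (lists xs n)) xs (const 1) ⟩
  ∑ xs (λ x → ∑ (map (x ∷_) (lists xs n)) (const 1))          ≡⟨ ∑-cong xs (λ x → trans (∑-map (x ∷_) (lists xs n) (const 1)) (trans (∑-length (lists xs n)) (length-lists xs n))) ⟩
  ∑ xs (const (length xs ^ n))                                ≡⟨ ∑-const xs _ ⟩
  length xs ^ suc n                                           ∎
  where open ≡-Reasoning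

∈-lists : (xs l : List A) → All (_∈ xs) l → l ∈ lists xs (length l)
∈-lists xs []      []         = here refl
∈-lists xs (x ∷ l) (x∈ ∷ l∈) =
  ∈-concatMap⁺ _ (Any.map (λ { refl → ∈-map⁺ (x ∷_) (∈-lists xs l l∈) }) x∈)

-- Sums over this list, relative to its length, are expectations over a uniformly random labelling.
funs : (Q L : ℕ) → List (Fin L → Fin Q)
funs Q zero    = (λ ()) ∷ []
funs Q (suc L) = concatMap (λ c → map (c ◂_) (funs Q L)) (allFin Q)

∑-funs : ∀ Q L (f : (Fin (suc L) → Fin Q) → ℕ) →
         ∑ (funs Q (suc L)) f ≡ ∑ (allFin Q) (λ c → ∑ (funs Q L) (λ ω → f (c ◂ ω)))
∑-funs Q L f = trans (∑-concatMap (λ c → map (c ◂_) (funs Q L)) (allFin Q) f)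
                     (∑-cong (allFin Q) (λ c → ∑-map (c ◂_) (funs Q L) f))

∑-allFin-const : ∀ n c → ∑ (allFin n) (const c) ≡ n * c
∑-allFin-const n c = trans (∑-const (allFin n) c) (cong (_* c) (length-tabulate {n = n} id))

length-funs-suc : ∀ Q L → length (funs Q (suc L)) ≡ Q * length (funs Q L)
length-funs-suc Q L = begin
  length (funs Q (suc L))                         ≡⟨ sym (∑-length (funs Q (suc L))) ⟩
  ∑ (funs Q (suc L)) (const 1)                    ≡⟨ ∑-funs Q L (const 1) ⟩
  ∑ (allFin Q) (λ c → ∑ (funs Q L) (const 1))     ≡⟨ ∑-cong (allFin Q) (λ _ → ∑-length (funs Q L)) ⟩
  ∑ (allFin Q) (const (length (funs Q L)))        ≡⟨ ∑-allFin-const Q _ ⟩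
  Q * length (funs Q L)                           ∎
  where open ≡-Reasoning

length-funs>0 : ∀ Q L → 0 < Q → 0 < length (funs Q L)
length-funs>0 Q zero    Q>0 = z<s
length-funs>0 Q (suc L) Q>0 = ≤-trans (*-mono-≤ Q>0 (length-funs>0 Q L Q>0)) (≤-reflexive (sym (length-funs-suc Q L)))

DependsOn : ∀ {Q L} → (Fin L → Bool) → ((Fin L → Fin Q) → ℕ) → Set
DependsOn S f = ∀ ω ω′ → (∀ i → S i ≡ true → ω i ≡ ω′ i) → f ω ≡ f ω′

-- `E[f g] = E[f] E[g]` without denominators. Each coordinate lies in the support of only one
-- factor; the partial sum of the other factor does not change with it and can be pulled out.
∑-funs-independent : ∀ Q L (S : Fin L → Bool) (f g : (Fin L → Fin Q) → ℕ) →
  DependsOn S f → DependsOn (not ∘ S) g →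
  length (funs Q L) * ∑ (funs Q L) (λ ω → f ω * g ω) ≡ ∑ (funs Q L) f * ∑ (funs Q L) g
∑-funs-independent Q zero S f g _ _ = base (f _) (g _)
  where
  base : ∀ a b → 1 * (a * b + 0) ≡ (a + 0) * (b + 0)
  base = solve-∀
∑-funs-independent Q (suc L) S f g df dg = go (S zero) refl
  where
  open ≡-Reasoning
  N = length (funs Q L)
  Ω = funs Q L
  F G : Fin Q → ℕ
  F c = ∑ Ω (λ ω → f (c ◂ ω))
  G c = ∑ Ω (λ ω → g (c ◂ ω))
  extend : ∀ {h} {S : Fin (suc L) → Bool} → DependsOn {Q} S h → ∀ c → DependsOn (S ∘ suc) (λ ω → h (c ◂ ω))
  extend dh c ω ω′ eq = dh (c ◂ ω) (c ◂ ω′) λ { zero _ → refl ; (suc i) → eq i }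
  constant : ∀ {h} {S : Fin (suc L) → Bool} → DependsOn {Q} S h → S zero ≡ false → ∀ c c′ →
             ∑ Ω (λ ω → h (c ◂ ω)) ≡ ∑ Ω (λ ω → h (c′ ◂ ω))
  constant dh s0 c c′ = ∑-cong Ω (λ ω → dh (c ◂ ω) (c′ ◂ ω) λ { zero s → case-false (trans (sym s0) s) ; (suc i) _ → refl })
    where
    case-false : ∀ {X : Set} → false ≡ true → X
    case-false ()
  product-sum : (∀ c c′ → F c * G c ≡ F c * G c′) ⊎ (∀ c c′ → F c * G c ≡ F c′ * G c) →
                ∑ (allFin Q) (λ c → Q * (F c * G c)) ≡ ∑ (allFin Q) F * ∑ (allFin Q) G
  product-sum (inj₁ h) = trans
    (∑-cong (allFin Q) (λ c → trans (sym (∑-allFin-const Q _)) (trans (∑-cong (allFin Q) (h c)) (∑-*ˡ (allFin Q) (F c) G))))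
    (∑-*ʳ (allFin Q) F _)
  product-sum (inj₂ h) = trans
    (∑-cong (allFin Q) (λ c → trans (sym (∑-allFin-const Q _)) (trans (∑-cong (allFin Q) (h c)) (∑-*ʳ (allFin Q) F (G c)))))
    (∑-*ˡ (allFin Q) (∑ (allFin Q) F) G)
  reorder : ∀ q n x → q * n * x ≡ q * (n * x)
  reorder = solve-∀
  finish : (∀ c c′ → F c * G c ≡ F c * G c′) ⊎ (∀ c c′ → F c * G c ≡ F c′ * G c) →
           length (funs Q (suc L)) * ∑ (funs Q (suc L)) (λ ω → f ω * g ω) ≡ ∑ (funs Q (suc L)) f * ∑ (funs Q (suc L)) g
  finish h = begin
    length (funs Q (suc L)) * ∑ (funs Q (suc L)) (λ ω → f ω * g ω)
      ≡⟨ cong₂ _*_ (length-funs-suc Q L) (∑-funs Q L (λ ω → f ω * g ω)) ⟩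
    Q * N * ∑ (allFin Q) (λ c → ∑ Ω (λ ω → f (c ◂ ω) * g (c ◂ ω)))
      ≡⟨ sym (∑-*ˡ (allFin Q) (Q * N) _) ⟩
    ∑ (allFin Q) (λ c → Q * N * ∑ Ω (λ ω → f (c ◂ ω) * g (c ◂ ω)))
      ≡⟨ ∑-cong (allFin Q) (λ c → trans (reorder Q N _)
           (cong (Q *_) (∑-funs-independent Q L (S ∘ suc) _ _ (extend df c) (extend dg c)))) ⟩
    ∑ (allFin Q) (λ c → Q * (F c * G c))
      ≡⟨ product-sum h ⟩
    ∑ (allFin Q) F * ∑ (allFin Q) G
      ≡⟨ sym (cong₂ _*_ (∑-funs Q L f) (∑-funs Q L g)) ⟩
    ∑ (funs Q (suc L)) f * ∑ (funs Q (suc L)) g ∎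
  go : (s : Bool) → S zero ≡ s → length (funs Q (suc L)) * ∑ (funs Q (suc L)) (λ ω → f ω * g ω) ≡ ∑ (funs Q (suc L)) f * ∑ (funs Q (suc L)) g
  go true  s = finish (inj₁ (λ c c′ → cong (F c *_) (constant dg (cong not s) c c′)))
  go false s = finish (inj₂ (λ c c′ → cong (_* G c) (constant df s c c′)))

∑-below : ∀ Q T → T ≤ Q → ∑ (allFin Q) (λ c → 𝟙 (toℕ c <? T)) ≡ T
∑-below Q zero _ = trans (∑-cong (allFin Q) (λ c → 𝟙-false (toℕ c <? 0) λ ())) (trans (∑-allFin-const Q 0) (*-zeroʳ Q))
∑-below (suc Q) (suc T) (s≤s T≤Q) = trans (∑-allFin-suc {Q} (λ c → 𝟙 (toℕ c <? suc T)))
  (cong suc (trans (∑-cong (allFin Q) (λ c → 𝟙-cong (suc (toℕ c) <? suc T) (toℕ c <? T) s≤s⁻¹ s≤s)) (∑-below Q T T≤Q)))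

∑-accepts : ∀ Q L c T → T ≤ Q → Q * ∑ (funs Q L) (λ ω → 𝟙 (toℕ (ω c) <? T)) ≡ T * length (funs Q L)
∑-accepts Q (suc L) zero T T≤Q = begin
  Q * ∑ (funs Q (suc L)) (λ ω → 𝟙 (toℕ (ω zero) <? T))  ≡⟨ cong (Q *_) (∑-funs Q L _) ⟩
  Q * ∑ (allFin Q) (λ c → ∑ (funs Q L) (λ ω → 𝟙 (toℕ c <? T)))
    ≡⟨ cong (Q *_) (trans (∑-cong (allFin Q) (λ c → trans (∑-const (funs Q L) _) (*-comm _ (𝟙 (toℕ c <? T))))) (∑-*ʳ (allFin Q) _ _)) ⟩
  Q * (∑ (allFin Q) (λ c → 𝟙 (toℕ c <? T)) * length (funs Q L))  ≡⟨ cong (λ z → Q * (z * length (funs Q L))) (∑-below Q T T≤Q) ⟩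
  Q * (T * length (funs Q L))      ≡⟨ reorder Q T _ ⟩
  T * (Q * length (funs Q L))      ≡⟨ cong (T *_) (sym (length-funs-suc Q L)) ⟩
  T * length (funs Q (suc L))      ∎
  where
  open ≡-Reasoning
  reorder : ∀ q t x → q * (t * x) ≡ t * (q * x)
  reorder = solve-∀
∑-accepts Q (suc L) (suc c) T T≤Q = begin
  Q * ∑ (funs Q (suc L)) (λ ω → 𝟙 (toℕ (ω (suc c)) <? T))  ≡⟨ cong (Q *_) (trans (∑-funs Q L _) (∑-allFin-const Q _)) ⟩
  Q * (Q * ∑ (funs Q L) (λ ω → 𝟙 (toℕ (ω c) <? T)))        ≡⟨ cong (Q *_) (∑-accepts Q L c T T≤Q) ⟩
  Q * (T * length (funs Q L))      ≡⟨ reorder Q T _ ⟩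
  T * (Q * length (funs Q L))      ≡⟨ cong (T *_) (sym (length-funs-suc Q L)) ⟩
  T * length (funs Q (suc L))      ∎
  where
  open ≡-Reasoning
  reorder : ∀ q t x → q * (t * x) ≡ t * (q * x)
  reorder = solve-∀

-- Probability that a family of disjoint link sets is missed

bernoulli : ∀ y n → (y + n) * y ^ n ≤ y * suc y ^ n
bernoulli y zero    = ≤-reflexive (base y)
  where
  base : ∀ y → (y + 0) * 1 ≡ y * 1
  base = solve-∀
bernoulli y (suc n) = begin
  (y + suc n) * (y * y ^ n)               ≤⟨ m≤m+n _ (n * y ^ n) ⟩
  (y + suc n) * (y * y ^ n) + n * y ^ n   ≡⟨ expand y n (y ^ n) ⟩
  suc y * ((y + n) * y ^ n)               ≤⟨ *-monoʳ-≤ (suc y) (bernoulli y n) ⟩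
  suc y * (y * suc y ^ n)                 ≡⟨ exchange y (suc y ^ n) ⟩
  y * (suc y * suc y ^ n)                 ∎
  where
  open ≤-Reasoning
  expand : ∀ y n z → (y + suc n) * (y * z) + n * z ≡ suc y * ((y + n) * z)
  expand = solve-∀
  exchange : ∀ y z → suc y * (y * z) ≡ y * (suc y * z)
  exchange = solve-∀

-- `(1 − 1/x) ^ x ≤ 1/2`: independent trials of success probability `1/x`, repeated `x` times, all
-- fail with probability at most one half. For `x ≥ 2` it is Bernoulli's inequality with `y = x − 1`
-- and `n = x`.
pred-power-half : ∀ x → 0 < x → 2 * pred x ^ x ≤ x ^ x
pred-power-half (suc zero)    _ = z≤n
pred-power-half (suc (suc y)) _ = *-cancelˡ-≤ (suc y) (begin
  suc y * (2 * suc y ^ suc (suc y))                 ≡⟨ double (suc y) _ ⟩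
  (suc y + suc y) * suc y ^ suc (suc y)             ≤⟨ *-monoˡ-≤ (suc y ^ suc (suc y)) (+-monoʳ-≤ (suc y) (n≤1+n (suc y))) ⟩
  (suc y + suc (suc y)) * suc y ^ suc (suc y)       ≤⟨ bernoulli (suc y) (suc (suc y)) ⟩
  suc y * suc (suc y) ^ suc (suc y)                 ∎)
  where
  open ≤-Reasoning
  double : ∀ a b → a * (2 * b) ≡ (a + a) * b
  double = solve-∀

-- A label is uniform in `Fin Q` and a link is accepted when its label is below `thr c`, so `k c` is
-- the exponent of the acceptance probability `2 ^ −k c`.
module Acceptance (Q L : ℕ) (Q>0 : 0 < Q) (thr : Fin L → ℕ) (k : Fin L → ℕ)
  (thr-k : ∀ c → thr c * 2 ^ k c ≡ Q) where

  Ω : List (Fin L → Fin Q)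
  Ω = funs Q L

  Accepts : (Fin L → Fin Q) → Fin L → Set
  Accepts ω c = toℕ (ω c) < thr c

  accepts? : ∀ ω c → Dec (Accepts ω c)
  accepts? ω c = toℕ (ω c) <? thr c

  acceptsAll? : ∀ ω S → Dec (All (Accepts ω) S)
  acceptsAll? ω = all? (accepts? ω)

  Misses : List (List (Fin L)) → (Fin L → Fin Q) → Set
  Misses F ω = All (λ S → ¬ All (Accepts ω) S) F

  misses? : ∀ F ω → Dec (Misses F ω)
  misses? F ω = all? (λ S → ¬? (acceptsAll? ω S)) F

  thr≤Q : ∀ c → thr c ≤ Q
  thr≤Q c = ≤-trans (m≤m*n (thr c) (2 ^ k c) {{m^n≢0 2 (k c)}}) (≤-reflexive (thr-k c))

  private
    N : ℕ
    N = length Ω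
    instance
      N≢0 : NonZero N
      N≢0 = >-nonZero (length-funs>0 Q L Q>0)
      Q≢0 : NonZero Q
      Q≢0 = >-nonZero Q>0

  accepts-probability : ∀ c → 2 ^ k c * ∑ Ω (λ ω → 𝟙 (accepts? ω c)) ≡ N
  accepts-probability c = *-cancelˡ-≡ _ _ Q (begin
    Q * (2 ^ k c * ∑ Ω (λ ω → 𝟙 (accepts? ω c)))   ≡⟨ exchange Q (2 ^ k c) _ ⟩
    2 ^ k c * (Q * ∑ Ω (λ ω → 𝟙 (accepts? ω c)))   ≡⟨ cong (2 ^ k c *_) (∑-accepts Q L c (thr c) (thr≤Q c)) ⟩
    2 ^ k c * (thr c * N)                          ≡⟨ regroup (2 ^ k c) (thr c) N ⟩
    thr c * 2 ^ k c * N                            ≡⟨ cong (_* N) (thr-k c) ⟩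
    Q * N                                          ∎)
    where
    open ≡-Reasoning
    exchange : ∀ a b c → a * (b * c) ≡ b * (a * c)
    exchange = solve-∀
    regroup : ∀ a b c → a * (b * c) ≡ b * a * c
    regroup = solve-∀

  -- Distinct links have independent labels, so their exponents add. A repeated link adds to the
  -- exponent but imposes no condition, hence an inequality; padded link sets do contain
  -- repetitions.
  acceptsAll-probability : ∀ S → N ≤ 2 ^ ∑ S k * ∑ Ω (λ ω → 𝟙 (acceptsAll? ω S))
  acceptsAll-probability [] = ≤-reflexive (sym (trans (+-identityʳ _) (∑-length Ω)))
  acceptsAll-probability (c ∷ S) with _∈?_ Fin._≟_ c S
  ... | yes c∈S = begin
    N                                                           ≤⟨ acceptsAll-probability S ⟩
    2 ^ ∑ S k * ∑ Ω (λ ω → 𝟙 (acceptsAll? ω S))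
      ≤⟨ *-mono-≤ (^-monoʳ-≤ 2 (m≤n+m (∑ S k) (k c)))
           (∑-mono Ω (λ ω → 𝟙-mono (acceptsAll? ω S) (acceptsAll? ω (c ∷ S)) (λ a → All.lookup a c∈S ∷ a))) ⟩
    2 ^ (k c + ∑ S k) * ∑ Ω (λ ω → 𝟙 (acceptsAll? ω (c ∷ S)))   ∎
    where open ≤-Reasoning
  ... | no c∉S = *-cancelˡ-≤ N (begin
    N * N
      ≤⟨ *-mono-≤ (≤-reflexive (sym (accepts-probability c))) (acceptsAll-probability S) ⟩
    (2 ^ k c * ∑ Ω f) * (2 ^ ∑ S k * ∑ Ω g)
      ≡⟨ regroup (2 ^ k c) (∑ Ω f) (2 ^ ∑ S k) (∑ Ω g) ⟩
    (2 ^ k c * 2 ^ ∑ S k) * (∑ Ω f * ∑ Ω g)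
      ≡⟨ cong₂ _*_ (sym (^-distribˡ-+-* 2 (k c) (∑ S k))) (sym (∑-funs-independent Q L at f g f-dep g-dep)) ⟩
    2 ^ (k c + ∑ S k) * (N * ∑ Ω (λ ω → f ω * g ω))
      ≡⟨ exchange (2 ^ (k c + ∑ S k)) N _ ⟩
    N * (2 ^ (k c + ∑ S k) * ∑ Ω (λ ω → f ω * g ω))
      ≡⟨ cong (λ z → N * (2 ^ (k c + ∑ S k) * z)) (∑-cong Ω (λ ω → trans (sym (𝟙-× (accepts? ω c) (acceptsAll? ω S)))
           (𝟙-cong (accepts? ω c ×-dec acceptsAll? ω S) (acceptsAll? ω (c ∷ S)) (λ { (a , b) → a ∷ b }) (λ { (a ∷ b) → a , b })))) ⟩
    N * (2 ^ (k c + ∑ S k) * ∑ Ω (λ ω → 𝟙 (acceptsAll? ω (c ∷ S)))) ∎)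
    where
    open ≤-Reasoning
    f g : (Fin L → Fin Q) → ℕ
    f ω = 𝟙 (accepts? ω c)
    g ω = 𝟙 (acceptsAll? ω S)
    at : Fin L → Bool
    at i = does (i Fin.≟ c)
    f-dep : DependsOn at f
    f-dep ω ω′ eq = cong (λ z → 𝟙 (toℕ z <? thr c)) (eq c (dec-true (c Fin.≟ c) refl))
    g-dep : DependsOn (not ∘ at) g
    g-dep ω ω′ eq = 𝟙-cong (acceptsAll? ω S) (acceptsAll? ω′ S) (transfer ω ω′ eq) (transfer ω′ ω (λ i → sym ∘ eq i))
      where
      transfer : ∀ ω ω′ → (∀ i → not (at i) ≡ true → ω i ≡ ω′ i) → All (Accepts ω) S → All (Accepts ω′) S
      transfer ω ω′ eq a = All.tabulate (λ {d} d∈S → subst (λ z → toℕ z < thr d)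
        (eq d (cong not (dec-false (d Fin.≟ c) (λ { refl → c∉S d∈S })))) (All.lookup a d∈S))
    regroup : ∀ a b c d → (a * b) * (c * d) ≡ (a * c) * (b * d)
    regroup = solve-∀
    exchange : ∀ a b c → a * (b * c) ≡ b * (a * c)
    exchange = solve-∀

  rejects-probability : ∀ S K → ∑ S k ≤ K → 2 ^ K * ∑ Ω (λ ω → 𝟙 (¬? (acceptsAll? ω S))) ≤ pred (2 ^ K) * N
  rejects-probability S K κ≤K = +-cancelʳ-≤ N _ _ (begin
    2 ^ K * R + N                       ≤⟨ +-monoʳ-≤ (2 ^ K * R) (acceptsAll-probability S) ⟩
    2 ^ K * R + 2 ^ ∑ S k * Y           ≤⟨ +-monoʳ-≤ (2 ^ K * R) (*-monoˡ-≤ Y (^-monoʳ-≤ 2 κ≤K)) ⟩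
    2 ^ K * R + 2 ^ K * Y               ≡⟨ sym (*-distribˡ-+ (2 ^ K) R Y) ⟩
    2 ^ K * (R + Y)                     ≡⟨ cong (2 ^ K *_) (trans (sym (∑-+ Ω _ _)) (trans (∑-cong Ω (λ ω → 𝟙-¬ (acceptsAll? ω S))) (∑-length Ω))) ⟩
    2 ^ K * N                           ≡⟨ cong (_* N) (sym (suc-pred (2 ^ K) {{m^n≢0 2 K}})) ⟩
    N + pred (2 ^ K) * N                ≡⟨ +-comm N _ ⟩
    pred (2 ^ K) * N + N                ∎)
    where
    open ≤-Reasoning
    R Y : ℕ
    R = ∑ Ω (λ ω → 𝟙 (¬? (acceptsAll? ω S)))
    Y = ∑ Ω (λ ω → 𝟙 (acceptsAll? ω S))

  -- Links accepted by every labelling (threshold Q) may be shared: they carry no randomness.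
  Disjoint : List (Fin L) → List (Fin L) → Set
  Disjoint S S′ = ∀ c → c ∈ S → c ∈ S′ → thr c ≡ Q

  -- Rejections of the members of `F` are independent events: the first one depends only on those of
  -- its links whose threshold is not `Q`, and disjointness keeps these out of all later sets.
  misses-probability : ∀ F K → All (λ S → ∑ S k ≤ K) F → AllPairs Disjoint F →
    (2 ^ K) ^ length F * ∑ Ω (λ ω → 𝟙 (misses? F ω)) ≤ pred (2 ^ K) ^ length F * N
  misses-probability [] K _ _ = +-monoˡ-≤ 0 (≤-reflexive (∑-length Ω))
  misses-probability (S ∷ F) K (κ≤K ∷ κs) (S-disj ∷ disj) = *-cancelˡ-≤ N (begin
    N * (X * X ^ ℓ * ∑ Ω (λ ω → 𝟙 (misses? (S ∷ F) ω)))
      ≡⟨ cong (λ z → N * (X * X ^ ℓ * z)) (∑-cong Ω (λ ω → trans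
           (𝟙-cong (misses? (S ∷ F) ω) (¬? (acceptsAll? ω S) ×-dec misses? F ω) (λ { (a ∷ b) → a , b }) (λ { (a , b) → a ∷ b }))
           (𝟙-× (¬? (acceptsAll? ω S)) (misses? F ω)))) ⟩
    N * (X * X ^ ℓ * ∑ Ω (λ ω → f ω * g ω))     ≡⟨ exchange N (X * X ^ ℓ) _ ⟩
    X * X ^ ℓ * (N * ∑ Ω (λ ω → f ω * g ω))     ≡⟨ cong (X * X ^ ℓ *_) (∑-funs-independent Q L on f g f-dep g-dep) ⟩
    X * X ^ ℓ * (∑ Ω f * ∑ Ω g)                 ≡⟨ regroup X (X ^ ℓ) (∑ Ω f) (∑ Ω g) ⟩
    (X * ∑ Ω f) * (X ^ ℓ * ∑ Ω g)               ≤⟨ *-mono-≤ (rejects-probability S K κ≤K) (misses-probability F K κs disj) ⟩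
    (pred X * N) * (pred X ^ ℓ * N)             ≡⟨ collect (pred X) N (pred X ^ ℓ) ⟩
    N * (pred X * pred X ^ ℓ * N)               ∎)
    where
    open ≤-Reasoning
    X ℓ : ℕ
    X = 2 ^ K
    ℓ = length F
    f g : (Fin L → Fin Q) → ℕ
    f ω = 𝟙 (¬? (acceptsAll? ω S))
    g ω = 𝟙 (misses? F ω)
    on? : ∀ i → Dec (i ∈ S × thr i ≢ Q)
    on? i = _∈?_ Fin._≟_ i S ×-dec ¬? (thr i ≟ Q)
    on : Fin L → Bool
    on i = does (on? i)
    full : ∀ ω i → thr i ≡ Q → Accepts ω i
    full ω i eq = subst (toℕ (ω i) <_) (sym eq) (Fin.toℕ<n (ω i))
    f-dep : DependsOn on f
    f-dep ω ω′ eq = 𝟙-cong (¬? (acceptsAll? ω S)) (¬? (acceptsAll? ω′ S))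
      (λ h → h ∘ transfer ω′ ω (λ i → sym ∘ eq i)) (λ h → h ∘ transfer ω ω′ eq)
      where
      transfer : ∀ ω ω′ → (∀ i → on i ≡ true → ω i ≡ ω′ i) → All (Accepts ω) S → All (Accepts ω′) S
      transfer ω ω′ eq a = All.tabulate (λ {d} d∈S → move d d∈S (thr d ≟ Q))
        where
        move : ∀ d → d ∈ S → Dec (thr d ≡ Q) → Accepts ω′ d
        move d d∈S (yes t) = full ω′ d t
        move d d∈S (no ¬t) = subst (λ z → toℕ z < thr d) (eq d (dec-true (on? d) (d∈S , ¬t))) (All.lookup a d∈S)
    g-dep : DependsOn (not ∘ on) g
    g-dep ω ω′ eq = 𝟙-cong (misses? F ω) (misses? F ω′) (move ω ω′ eq) (move ω′ ω (λ i → sym ∘ eq i))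
      where
      move : ∀ ω ω′ → (∀ i → not (on i) ≡ true → ω i ≡ ω′ i) → Misses F ω → Misses F ω′
      move ω ω′ eq m = All.tabulate (λ {S′} S′∈F a → All.lookup m S′∈F (All.tabulate (λ {d} d∈S′ →
        subst (λ z → toℕ z < thr d)
          (sym (eq d (cong not (dec-false (on? d) (λ { (d∈S , ¬t) → ¬t (All.lookup S-disj S′∈F d d∈S d∈S′) })))))
          (All.lookup a d∈S′))))
    exchange : ∀ a b c → a * (b * c) ≡ b * (a * c)
    exchange = solve-∀
    regroup : ∀ a b c d → a * b * (c * d) ≡ (a * c) * (b * d)
    regroup = solve-∀
    collect : ∀ a n b → (a * n) * (b * n) ≡ n * (a * b * n)
    collect = solve-∀

  -- With `2 ^ K` independent sets, each accepted with probability at least `2 ^ −K`, this is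
  -- `pred-power-half` at `x = 2 ^ K`.
  misses-half : ∀ F K → length F ≡ 2 ^ K → All (λ S → ∑ S k ≤ K) F → AllPairs Disjoint F →
    2 * ∑ Ω (λ ω → 𝟙 (misses? F ω)) ≤ N
  misses-half F K len κs disj = *-cancelˡ-≤ (X ^ X) {{m^n≢0 X X {{m^n≢0 2 K}}}} (begin
    X ^ X * (2 * E)              ≡⟨ exchange (X ^ X) 2 E ⟩
    2 * (X ^ X * E)              ≡⟨ cong (λ z → 2 * (X ^ z * E)) (sym len) ⟩
    2 * (X ^ length F * E)       ≤⟨ *-monoʳ-≤ 2 (misses-probability F K κs disj) ⟩
    2 * (pred X ^ length F * N)  ≡⟨ cong (λ z → 2 * (pred X ^ z * N)) len ⟩
    2 * (pred X ^ X * N)         ≡⟨ sym (*-assoc 2 (pred X ^ X) N) ⟩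
    2 * pred X ^ X * N           ≤⟨ *-monoˡ-≤ N (pred-power-half X (m^n>0 2 K)) ⟩
    X ^ X * N                    ∎)
    where
    open ≤-Reasoning
    X E : ℕ
    X = 2 ^ K
    E = ∑ Ω (λ ω → 𝟙 (misses? F ω))
    exchange : ∀ a b c → a * (b * c) ≡ b * (a * c)
    exchange = solve-∀

-- Derandomisation

-- Labellings are chosen one after another so that the total weight 1 + ∑ 4^(number of misses)
-- grows by a factor of at most 13/4 each time, while the cost stays within thrice its average.
module Potential {Fam Om : Set} (Ω : List Om) (Ω>0 : 0 < length Ω) (𝔽 : List Fam)
  {Miss : Fam → Om → Set} (miss? : ∀ F ω → Dec (Miss F ω))
  (half : ∀ F → F ∈ 𝔽 → 2 * ∑ Ω (λ ω → 𝟙 (miss? F ω)) ≤ length Ω)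
  (cost : Om → ℕ) (B : ℕ) (B>0 : 0 < B) (cost-average : ∑ Ω cost ≤ length Ω * B) where

  choose-one : (u : Fam → ℕ) → ∃ λ ω → cost ω ≤ 3 * B ×
               4 * ∑ 𝔽 (λ F → u F * 𝟙 (miss? F ω)) ≤ 3 * (1 + ∑ 𝔽 u)
  choose-one u = ω , cost-ok , weight-ok
    where
    open ≤-Reasoning
    U N : ℕ
    U = ∑ 𝔽 u
    N = length Ω
    missed Z : Om → ℕ
    missed ω = ∑ 𝔽 (λ F → u F * 𝟙 (miss? F ω))
    -- Both goals are read off one average. The mean of `Z` is at most `2 B U + (1 + U) B`, hence at
    -- most `3 B (1 + U)`; dropping either summand leaves one of the bounds. The `1 +` keeps the
    -- cost bound alive when `U = 0`.
    Z ω = 4 * B * missed ω + (1 + U) * cost ω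
    ∑missed : 2 * ∑ Ω missed ≤ N * U
    ∑missed = begin
      2 * ∑ Ω missed                                              ≡⟨ cong (2 *_) (∑-swap Ω 𝔽 _) ⟩
      2 * ∑ 𝔽 (λ F → ∑ Ω (λ ω → u F * 𝟙 (miss? F ω)))       ≡⟨ sym (∑-*ˡ 𝔽 2 _) ⟩
      ∑ 𝔽 (λ F → 2 * ∑ Ω (λ ω → u F * 𝟙 (miss? F ω)))       ≤⟨ ∑-mono-∈ 𝔽 (λ F F∈ → ≤-trans
          (≤-reflexive (trans (cong (2 *_) (∑-*ˡ Ω (u F) _)) (exchange 2 (u F) _))) (*-monoʳ-≤ (u F) (half F F∈))) ⟩
      ∑ 𝔽 (λ F → u F * N)                                   ≡⟨ ∑-*ʳ 𝔽 u N ⟩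
      U * N                                                 ≡⟨ *-comm U N ⟩
      N * U                                                 ∎
      where
      exchange : ∀ a b c → a * (b * c) ≡ b * (a * c)
      exchange = solve-∀
    ∑Z : ∑ Ω Z ≤ N * (3 * B * (1 + U))
    ∑Z = begin
      ∑ Ω Z                                       ≡⟨ trans (∑-+ Ω _ _) (cong₂ _+_ (∑-*ˡ Ω (4 * B) missed) (∑-*ˡ Ω (1 + U) cost)) ⟩
      4 * B * ∑ Ω missed + (1 + U) * ∑ Ω cost          ≡⟨ cong (_+ (1 + U) * ∑ Ω cost) (halve B (∑ Ω missed)) ⟩
      2 * B * (2 * ∑ Ω missed) + (1 + U) * ∑ Ω cost    ≤⟨ +-mono-≤ (*-monoʳ-≤ (2 * B) ∑missed) (*-monoʳ-≤ (1 + U) cost-average) ⟩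
      2 * B * (N * U) + (1 + U) * (N * B)         ≤⟨ m≤m+n _ (2 * B * N) ⟩
      2 * B * (N * U) + (1 + U) * (N * B) + 2 * B * N   ≡⟨ collect B N U ⟩
      N * (3 * B * (1 + U))                       ∎
      where
      halve : ∀ b a → 4 * b * a ≡ 2 * b * (2 * a)
      halve = solve-∀
      collect : ∀ b n u → 2 * b * (n * u) + (1 + u) * (n * b) + 2 * b * n ≡ n * (3 * b * (1 + u))
      collect = solve-∀
    best : ∃ λ ω → Z ω ≤ 3 * B * (1 + U)
    best = ∑-average Ω Z _ Ω>0 ∑Z
    ω : Om
    ω = proj₁ best
    cost-ok : cost ω ≤ 3 * B
    cost-ok = *-cancelˡ-≤ (1 + U) (≤-trans (m≤n+m _ (4 * B * missed ω)) (≤-trans (proj₂ best) (≤-reflexive (*-comm (3 * B) (1 + U)))))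
    weight-ok : 4 * missed ω ≤ 3 * (1 + U)
    weight-ok = *-cancelˡ-≤ B {{>-nonZero B>0}} (begin
      B * (4 * missed ω)        ≡⟨ swap₁ B (missed ω) ⟩
      4 * B * missed ω          ≤⟨ m≤m+n _ _ ⟩
      Z ω                  ≤⟨ proj₂ best ⟩
      3 * B * (1 + U)      ≡⟨ swap₂ B (1 + U) ⟩
      B * (3 * (1 + U))    ∎)
      where
      swap₁ : ∀ b a → b * (4 * a) ≡ 4 * b * a
      swap₁ = solve-∀
      swap₂ : ∀ b a → 3 * b * a ≡ b * (3 * a)
      swap₂ = solve-∀

  miss-count : ∀ {m} {M : Fin m → Set} → (∀ i → Dec (M i)) → (Fin m → Om) → Fam → ℕ
  miss-count {m} M? ωs F = ∑ (allFin m) (λ i → 𝟙 (M? i ×-dec miss? F (ωs i)))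

  -- `u` carries the weights accumulated by earlier choices, so the recursion passes `u′`. An index
  -- outside `M` multiplies no weight but still receives a labelling of small cost.
  choose-all : ∀ m {M : Fin m → Set} (M? : ∀ i → Dec (M i)) (u : Fam → ℕ) →
    let μ = ∑ (allFin m) (𝟙 ∘ M?) in
    ∃ λ (ωs : Fin m → Om) → (∀ i → cost (ωs i) ≤ 3 * B) ×
      4 ^ μ * (1 + ∑ 𝔽 (λ F → u F * 4 ^ miss-count M? ωs F)) ≤ 13 ^ μ * (1 + ∑ 𝔽 u)
  choose-all zero M? u = (λ ()) , (λ ()) , ≤-reflexive (cong (λ z → 1 * (1 + z)) (∑-cong 𝔽 (λ F → *-identityʳ (u F))))
  choose-all (suc m) {M} M? u = ω ◂ ωs , costs , bound
    where
    open ≤-Reasoning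
    one : ∃ λ ω → cost ω ≤ 3 * B × 4 * ∑ 𝔽 (λ F → u F * 𝟙 (miss? F ω)) ≤ 3 * (1 + ∑ 𝔽 u)
    one = choose-one u
    ω : Om
    ω = proj₁ one
    d : Fam → ℕ
    d F = 𝟙 (M? zero ×-dec miss? F ω)
    u′ : Fam → ℕ
    u′ F = u F * 4 ^ d F
    rest = choose-all m (M? ∘ suc) u′
    ωs = proj₁ rest
    costs : ∀ i → cost ((ω ◂ ωs) i) ≤ 3 * B
    costs zero    = proj₁ (proj₂ one)
    costs (suc i) = proj₁ (proj₂ rest) i
    δ ν : ℕ
    δ = 𝟙 (M? zero)
    ν = ∑ (allFin m) (𝟙 ∘ M? ∘ suc)
    grow : ∀ {P : Set} (p : Dec P) →
           4 ^ 𝟙 p * (1 + ∑ 𝔽 (λ F → u F * 4 ^ 𝟙 (p ×-dec miss? F ω))) ≤ 13 ^ 𝟙 p * (1 + ∑ 𝔽 u)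
    grow (no _)  = ≤-reflexive (cong (λ z → 1 * (1 + z)) (∑-cong 𝔽 (λ F → *-identityʳ (u F))))
    -- A miss multiplies a weight by 4, that is, adds three times the missed weight, and the missed
    -- weight is at most 3/4 of the total: `1 + 3 * 3/4 = 13/4`.
    grow (yes _) = begin
      4 * (1 + ∑ 𝔽 (λ F → u F * 4 ^ 𝟙 (miss? F ω)))
        ≡⟨ cong (λ z → 4 * (1 + z)) (∑-cong 𝔽 (λ F → linear (u F) (miss? F ω))) ⟩
      4 * (1 + ∑ 𝔽 (λ F → u F + 3 * (u F * 𝟙 (miss? F ω))))
        ≡⟨ cong (λ z → 4 * (1 + z)) (trans (∑-+ 𝔽 u _) (cong (∑ 𝔽 u +_) (∑-*ˡ 𝔽 3 _))) ⟩
      4 * (1 + (∑ 𝔽 u + 3 * ∑ 𝔽 (λ F → u F * 𝟙 (miss? F ω))))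
        ≡⟨ spread (∑ 𝔽 u) (∑ 𝔽 (λ F → u F * 𝟙 (miss? F ω))) ⟩
      4 * (1 + ∑ 𝔽 u) + 3 * (4 * ∑ 𝔽 (λ F → u F * 𝟙 (miss? F ω)))
        ≤⟨ +-monoʳ-≤ (4 * (1 + ∑ 𝔽 u)) (*-monoʳ-≤ 3 (proj₂ (proj₂ one))) ⟩
      4 * (1 + ∑ 𝔽 u) + 3 * (3 * (1 + ∑ 𝔽 u))
        ≡⟨ thirteen (1 + ∑ 𝔽 u) ⟩
      13 * (1 + ∑ 𝔽 u) ∎
      where
      linear : ∀ a {P : Set} (p : Dec P) → a * 4 ^ 𝟙 p ≡ a + 3 * (a * 𝟙 p)
      linear a (yes _) = four a
        where
        four : ∀ a → a * 4 ≡ a + 3 * (a * 1)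
        four = solve-∀
      linear a (no _)  = one′ a
        where
        one′ : ∀ a → a * 1 ≡ a + 3 * (a * 0)
        one′ = solve-∀
      spread : ∀ a b → 4 * (1 + (a + 3 * b)) ≡ 4 * (1 + a) + 3 * (4 * b)
      spread = solve-∀
      thirteen : ∀ a → 4 * a + 3 * (3 * a) ≡ 13 * a
      thirteen = solve-∀
    μ≡ : ∑ (allFin (suc m)) (𝟙 ∘ M?) ≡ δ + ν
    μ≡ = ∑-allFin-suc {m} (𝟙 ∘ M?)
    split : ∀ F → u F * 4 ^ miss-count M? (ω ◂ ωs) F ≡ u′ F * 4 ^ miss-count (M? ∘ suc) ωs F
    split F = trans (cong (λ z → u F * 4 ^ z) (∑-allFin-suc {m} (λ i → 𝟙 (M? i ×-dec miss? F ((ω ◂ ωs) i)))))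
      (trans (cong (u F *_) (^-distribˡ-+-* 4 (d F) (miss-count (M? ∘ suc) ωs F))) (sym (*-assoc (u F) (4 ^ d F) _)))
    bound : 4 ^ ∑ (allFin (suc m)) (𝟙 ∘ M?) * (1 + ∑ 𝔽 (λ F → u F * 4 ^ miss-count M? (ω ◂ ωs) F))
          ≤ 13 ^ ∑ (allFin (suc m)) (𝟙 ∘ M?) * (1 + ∑ 𝔽 u)
    bound = begin
      4 ^ ∑ (allFin (suc m)) (𝟙 ∘ M?) * (1 + ∑ 𝔽 (λ F → u F * 4 ^ miss-count M? (ω ◂ ωs) F))
        ≡⟨ cong₂ (λ a b → 4 ^ a * (1 + b)) μ≡ (∑-cong 𝔽 split) ⟩
      4 ^ (δ + ν) * T      ≡⟨ cong (_* T) (^-distribˡ-+-* 4 δ ν) ⟩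
      4 ^ δ * 4 ^ ν * T    ≡⟨ *-assoc (4 ^ δ) (4 ^ ν) T ⟩
      4 ^ δ * (4 ^ ν * T)  ≤⟨ *-monoʳ-≤ (4 ^ δ) (proj₂ (proj₂ rest)) ⟩
      4 ^ δ * (13 ^ ν * (1 + ∑ 𝔽 u′))  ≡⟨ swap₁ (4 ^ δ) (13 ^ ν) _ ⟩
      13 ^ ν * (4 ^ δ * (1 + ∑ 𝔽 u′))  ≤⟨ *-monoʳ-≤ (13 ^ ν) (grow (M? zero)) ⟩
      13 ^ ν * (13 ^ δ * (1 + ∑ 𝔽 u))  ≡⟨ swap₂ (13 ^ ν) (13 ^ δ) _ ⟩
      13 ^ δ * 13 ^ ν * (1 + ∑ 𝔽 u)    ≡⟨ cong (_* (1 + ∑ 𝔽 u)) (sym (^-distribˡ-+-* 13 δ ν)) ⟩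
      13 ^ (δ + ν) * (1 + ∑ 𝔽 u)       ≡⟨ cong (λ z → 13 ^ z * (1 + ∑ 𝔽 u)) (sym μ≡) ⟩
      13 ^ ∑ (allFin (suc m)) (𝟙 ∘ M?) * (1 + ∑ 𝔽 u) ∎
      where
      T : ℕ
      T = 1 + ∑ 𝔽 (λ F → u′ F * 4 ^ miss-count (M? ∘ suc) ωs F)
      swap₁ : ∀ a b c → a * (b * c) ≡ b * (a * c)
      swap₁ = solve-∀
      swap₂ : ∀ a b c → a * (b * c) ≡ b * a * c
      swap₂ = solve-∀

  -- A family with at most `N` hits is missed at least `μ − N` times and alone has weight at least
  -- `4 ^ (μ − N)`, while the total is at most `(13/4) ^ μ (1 + length 𝔽)`. As
  -- `2 * 13 ^ 4 ≤ 16 ^ 4`, the choice `μ = 4 x` makes `(16/13) ^ μ` at least `2 ^ x`, which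
  -- contradicts the smallness hypothesis.
  many-hits : ∀ m {M : Fin m → Set} (M? : ∀ i → Dec (M i)) (x N : ℕ) →
    ∑ (allFin m) (𝟙 ∘ M?) ≡ 4 * x → (1 + length 𝔽) * 4 ^ N < 2 ^ x →
    ∃ λ (ωs : Fin m → Om) → (∀ i → cost (ωs i) ≤ 3 * B) ×
      (∀ F → F ∈ 𝔽 → N < ∑ (allFin m) (λ i → 𝟙 (M? i ×-dec ¬? (miss? F (ωs i)))))
  many-hits m M? x N μ≡ small = ωs , proj₁ (proj₂ chosen) , hits
    where
    open ≤-Reasoning
    chosen = choose-all m M? (const 1)
    ωs = proj₁ chosen
    μ = ∑ (allFin m) (𝟙 ∘ M?)
    hit : Fam → ℕ
    hit F = ∑ (allFin m) (λ i → 𝟙 (M? i ×-dec ¬? (miss? F (ωs i))))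
    hit+miss : ∀ F → miss-count M? ωs F + hit F ≡ μ
    hit+miss F = trans (sym (∑-+ (allFin m) _ _)) (∑-cong (allFin m) (λ i → pointwise (M? i) (miss? F (ωs i))))
      where
      pointwise : ∀ {P Q : Set} (p : Dec P) (q : Dec Q) → 𝟙 (p ×-dec q) + 𝟙 (p ×-dec ¬? q) ≡ 𝟙 p
      pointwise (yes _) (yes _) = refl
      pointwise (yes _) (no _)  = refl
      pointwise (no _)  _       = refl
    powers : ∀ x → 2 ^ x * 13 ^ (4 * x) ≤ 16 ^ (4 * x)
    powers x = begin
      2 ^ x * 13 ^ (4 * x)     ≡⟨ cong (2 ^ x *_) (sym (^-*-assoc 13 4 x)) ⟩
      2 ^ x * (13 ^ 4) ^ x     ≡⟨ sym (^-distribʳ-* x 2 (13 ^ 4)) ⟩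
      (2 * 13 ^ 4) ^ x         ≤⟨ ^-monoˡ-≤ x (≤ᵇ⇒≤ (2 * 13 ^ 4) (16 ^ 4) _) ⟩
      (16 ^ 4) ^ x             ≡⟨ ^-*-assoc 16 4 x ⟩
      16 ^ (4 * x)             ∎
    hits : ∀ F → F ∈ 𝔽 → N < hit F
    hits F F∈ = ≰⇒> λ hit≤N → <⇒≱ small (*-cancelˡ-≤ (13 ^ (4 * x)) {{m^n≢0 13 (4 * x)}} (begin
      13 ^ (4 * x) * 2 ^ x          ≡⟨ *-comm (13 ^ (4 * x)) (2 ^ x) ⟩
      2 ^ x * 13 ^ (4 * x)          ≤⟨ powers x ⟩
      16 ^ (4 * x)                  ≡⟨ ^-*-assoc 4 2 (4 * x) ⟩
      4 ^ (2 * (4 * x))             ≡⟨ cong (λ z → 4 ^ (2 * z)) (sym μ≡) ⟩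
      4 ^ (2 * μ)                   ≡⟨ cong (4 ^_) (trans (cong (μ +_) (+-identityʳ μ)) (cong (μ +_) (sym (hit+miss F)))) ⟩
      4 ^ (μ + (miss-count M? ωs F + hit F))   ≡⟨ trans (^-distribˡ-+-* 4 μ _) (cong (4 ^ μ *_) (^-distribˡ-+-* 4 (miss-count M? ωs F) (hit F))) ⟩
      4 ^ μ * (4 ^ miss-count M? ωs F * 4 ^ hit F)   ≡⟨ sym (*-assoc (4 ^ μ) _ _) ⟩
      4 ^ μ * 4 ^ miss-count M? ωs F * 4 ^ hit F     ≤⟨ *-mono-≤ (*-monoʳ-≤ (4 ^ μ) (≤-trans (≤-reflexive (sym (*-identityˡ _)))
                                                          (≤-trans (∑-∈ (λ F → 1 * 4 ^ miss-count M? ωs F) F∈) (n≤1+n _))))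
                                                          (^-monoʳ-≤ 4 hit≤N) ⟩
      4 ^ μ * (1 + ∑ 𝔽 (λ F → 1 * 4 ^ miss-count M? ωs F)) * 4 ^ N   ≤⟨ *-monoˡ-≤ (4 ^ N) (proj₂ (proj₂ chosen)) ⟩
      13 ^ μ * (1 + ∑ 𝔽 (const 1)) * 4 ^ N    ≡⟨ cong₂ (λ a b → 13 ^ a * (1 + b) * 4 ^ N) μ≡ (∑-length 𝔽) ⟩
      13 ^ (4 * x) * (1 + length 𝔽) * 4 ^ N   ≡⟨ *-assoc (13 ^ (4 * x)) _ _ ⟩
      13 ^ (4 * x) * ((1 + length 𝔽) * 4 ^ N) ∎))

-- Lists

∑-filter : {P : A → Set} (P? : ∀ x → Dec (P x)) (xs : List A) (f : A → ℕ) →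
           ∑ (filter P? xs) f ≡ ∑ xs (λ x → 𝟙 (P? x) * f x)
∑-filter P? []       f = refl
∑-filter P? (x ∷ xs) f with P? x
... | yes _ = cong₂ _+_ (sym (+-identityʳ (f x))) (∑-filter P? xs f)
... | no  _ = ∑-filter P? xs f

length-filter-∑ : {P : A → Set} (P? : ∀ x → Dec (P x)) (xs : List A) → length (filter P? xs) ≡ ∑ xs (𝟙 ∘ P?)
length-filter-∑ P? xs = trans (sym (∑-length (filter P? xs)))
  (trans (∑-filter P? xs (const 1)) (∑-cong xs (λ x → *-identityʳ (𝟙 (P? x)))))

∑-filter-≤ : {P : A → Set} (P? : ∀ x → Dec (P x)) (xs : List A) (f : A → ℕ) → ∑ (filter P? xs) f ≤ ∑ xs f
∑-filter-≤ P? xs f = ≤-trans (≤-reflexive (∑-filter P? xs f)) (∑-mono xs (λ x → pointwise (P? x) (f x)))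
  where
  pointwise : ∀ {P : Set} (p : Dec P) a → 𝟙 p * a ≤ a
  pointwise (yes _) a = ≤-reflexive (+-identityʳ a)
  pointwise (no _)  a = z≤n

𝟙-any-≤ : {P : A → Set} (P? : ∀ x → Dec (P x)) (xs : List A) → 𝟙 (any? P? xs) ≤ ∑ xs (𝟙 ∘ P?)
𝟙-any-≤ P? xs = 𝟙-≤ (any? P? xs) (go xs)
  where
  go : ∀ xs → Any _ xs → 1 ≤ ∑ xs (𝟙 ∘ P?)
  go (x ∷ xs) (here p)  = ≤-trans (≤-reflexive (sym (𝟙-true (P? x) p))) (m≤m+n _ _)
  go (x ∷ xs) (there p) = ≤-trans (go xs p) (m≤n+m _ _)

-- Each chosen head discards at most `Δ` entries, so `Δ * s` entries last for `s` rounds.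
greedy-independent : {C : A → A → Set} (C? : ∀ x y → Dec (C x y)) (Δ : ℕ) → 0 < Δ → (s : ℕ) (X : List A) →
  (∀ x → x ∈ X → ∑ X (λ y → 𝟙 (C? x y)) ≤ Δ) → Δ * s ≤ length X →
  ∃ λ ys → length ys ≡ s × All (_∈ X) ys × AllPairs (λ x y → ¬ C x y) ys
greedy-independent C? Δ Δ>0 zero X _ _ = [] , refl , [] , []
greedy-independent C? Δ Δ>0 (suc s) [] _ large = contradiction large (<⇒≱ (≤-trans Δ>0 (m≤m*n Δ (suc s))))
greedy-independent {A} {C} C? Δ Δ>0 (suc s) X@(x ∷ _) few large =
  x ∷ proj₁ ih , cong suc (proj₁ (proj₂ ih)) ,
  here refl ∷ All.map (proj₁ ∘ ∈-filter⁻ (¬? ∘ C? x)) (proj₁ (proj₂ (proj₂ ih))) ,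
  All.map (proj₂ ∘ ∈-filter⁻ (¬? ∘ C? x) {xs = X}) (proj₁ (proj₂ (proj₂ ih))) ∷ proj₂ (proj₂ (proj₂ ih))
  where
  open ≤-Reasoning
  X′ : List A
  X′ = filter (¬? ∘ C? x) X
  large′ : Δ * s ≤ length X′
  large′ = +-cancelʳ-≤ Δ _ _ (begin
    Δ * s + Δ                                         ≡⟨ trans (+-comm _ Δ) (sym (*-suc Δ s)) ⟩
    Δ * suc s                                         ≤⟨ large ⟩
    length X                                          ≡⟨ sym (∑-length X) ⟩
    ∑ X (const 1)                                     ≡⟨ ∑-cong X (λ y → sym (𝟙-¬ (C? x y))) ⟩
    ∑ X (λ y → 𝟙 (¬? (C? x y)) + 𝟙 (C? x y))          ≡⟨ ∑-+ X (λ y → 𝟙 (¬? (C? x y))) (λ y → 𝟙 (C? x y)) ⟩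
    ∑ X (λ y → 𝟙 (¬? (C? x y))) + ∑ X (λ y → 𝟙 (C? x y))
      ≤⟨ +-mono-≤ (≤-reflexive (sym (length-filter-∑ (¬? ∘ C? x) X))) (few x (here refl)) ⟩
    length X′ + Δ                                     ∎)
  ih = greedy-independent C? Δ Δ>0 s X′
    (λ y y∈ → ≤-trans (∑-filter-≤ (¬? ∘ C? x) X _) (few y (proj₁ (∈-filter⁻ (¬? ∘ C? x) y∈)))) large′

maximal-element : {P : A → Set} (P? : ∀ x → Dec (P x)) (h : A → ℕ) (xs : List A) → Any P xs →
  ∃ λ x → x ∈ xs × P x × (∀ y → y ∈ xs → P y → h y ≤ h x)
maximal-element {P = P} P? h (x ∷ xs) some with any? P? xs
... | no ¬any = x , here refl , head-holds some , λ { y (here refl) _ → ≤-refl ; y (there y∈) py → contradiction (Any.map (λ { refl → py }) y∈) ¬any }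
  where
  head-holds : Any P (x ∷ xs) → P x
  head-holds (here p)  = p
  head-holds (there p) = contradiction p ¬any
... | yes rest with maximal-element P? h xs rest
...   | z , z∈ , pz , zmax with P? x
...     | no ¬px = z , there z∈ , pz , λ { y (here refl) py → contradiction py ¬px ; y (there y∈) → zmax y y∈ }
...     | yes px with h x ≤? h z
...       | yes hx≤hz = z , there z∈ , pz , λ { y (here refl) _ → hx≤hz ; y (there y∈) → zmax y y∈ }
...       | no hx≰hz  = x , here refl , px , λ { y (here refl) _ → ≤-refl ; y (there y∈) py → ≤-trans (zmax y y∈ py) (<⇒≤ (≰⇒> hx≰hz)) }

-- Families are enumerated as lists of sets of exactly `D` links. Repeating the head lengthens a set
-- without adding a condition.
pad : ℕ → List A → List A
pad d []      = []
pad d (c ∷ l) = (c ∷ l) ++ replicate (d ∸ length (c ∷ l)) c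

length-pad : ∀ d (l : List A) {c} → c ∈ l → length l ≤ d → length (pad d l) ≡ d
length-pad d (c ∷ l) _ l≤d = trans (length-++ (c ∷ l)) (trans (cong (length (c ∷ l) +_) (length-replicate _)) (m+[n∸m]≡n l≤d))

∈-pad⁺ : ∀ d {l : List A} {c} → c ∈ l → c ∈ pad d l
∈-pad⁺ d {_ ∷ _} c∈ = ∈-++⁺ˡ c∈

∈-pad⁻ : ∀ d {l : List A} {c} → c ∈ pad d l → c ∈ l
∈-pad⁻ d {c ∷ l} c∈ with ∈-++⁻ (c ∷ l) c∈
... | inj₁ p = p
... | inj₂ p = here (All.lookup {P = _≡ c} (All.replicate⁺ (d ∸ length (c ∷ l)) refl) p)

-- One link of small exponent saves `e − k c` out of `length S * e`; this saving is what turns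
-- `D * e` into `K e j`.
∑-one-smaller : (S : List A) (k : A → ℕ) (e : ℕ) {c : A} → (∀ x → k x ≤ e) → c ∈ S → ∑ S k + e ≤ length S * e + k c
∑-one-smaller (x ∷ S) k e k≤e (here refl) = begin
  k x + ∑ S k + e             ≤⟨ +-monoˡ-≤ e (+-monoʳ-≤ (k x) (∑-≤ S (λ y _ → k≤e y))) ⟩
  k x + length S * e + e      ≡⟨ reorder (k x) (length S * e) e ⟩
  e + length S * e + k x      ∎
  where
  open ≤-Reasoning
  reorder : ∀ a b e → a + b + e ≡ e + b + a
  reorder = solve-∀
∑-one-smaller (x ∷ S) k e {c} k≤e (there c∈) = begin
  k x + ∑ S k + e               ≡⟨ +-assoc (k x) _ e ⟩
  k x + (∑ S k + e)             ≤⟨ +-mono-≤ (k≤e x) (∑-one-smaller S k e k≤e c∈) ⟩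
  e + (length S * e + k c)      ≡⟨ sym (+-assoc e _ _) ⟩
  e + length S * e + k c        ∎
  where open ≤-Reasoning

argmax : ∀ {m} {P : Fin m → Set} (P? : ∀ v → Dec (P v)) (h : Fin m → ℕ) (bound : ℕ) → (∀ v → P v → h v ≤ bound) →
  ∃ P → ∃ λ v → P v × (∀ w → P w → h w ≤ h v)
argmax {P = P} P? h bound bounded (v , pv) = go bound v pv (m≤n+m bound (h v))
  where
  go : ∀ fuel v → P v → bound ≤ h v + fuel → ∃ λ v → P v × (∀ w → P w → h w ≤ h v)
  go zero v pv b≤ = v , pv , λ w pw → ≤-trans (bounded w pw) (≤-trans b≤ (≤-reflexive (+-identityʳ (h v))))
  go (suc fuel) v pv b≤ with Fin.any? (λ w → P? w ×-dec (h v <? h w))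
  ... | yes (w , pw , hv<hw) = go fuel w pw (≤-trans b≤ (≤-trans (≤-reflexive (+-suc (h v) fuel)) (+-monoˡ-≤ fuel hv<hw)))
  ... | no none = v , pv , λ w pw → ≮⇒≥ (λ hv<hw → none (w , pw , hv<hw))

-- Online embedding

allFin-inhabited : ∀ m (h : Fin m → ℕ) → 0 < ∑ (allFin m) h → Fin m
allFin-inhabited (suc m) h _ = zero

-- Vertices of `H` are numbered by their place in the ordering, hence `backward`. Links of `H` are
-- functions and are compared after `code`, where `code-cong` stands in for function extensionality.
module Embedding
  (D k₀ b n m L ρ : ℕ) (D>0 : 0 < D) (k₀≤Dk₀∸b : k₀ ≤ D * k₀ ∸ b) (1+k₀≤2^b : suc k₀ ≤ 2 ^ b)
  (lev : Fin m → ℕ) (lev≤k₀ : ∀ v → lev v ≤ k₀)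
  (first : Fin L → Fin m) (code : (Fin (suc ρ) → Fin m) → Fin L)
  (code-cong : ∀ u v → (∀ i → u i ≡ v i) → code u ≡ code v)
  (first-code : ∀ u → first (code u) ≡ u zero)
  (links : Fin n → List (Fin (suc ρ) → Fin n)) (links≤D : ∀ x → length (links x) ≤ D)
  (backward : ∀ x g → g ∈ links x → ∀ i → toℕ (g i) < toℕ x)
  where

  τ t : Fin L → ℕ
  τ c = k₀ ∸ lev (first c)
  t c = D * τ c ∸ b

  -- Bound for the exponent of a set of `D` links in level `e`: one link with `τ = j` that is not
  -- automatic costs `e ∸ (D * j ∸ b)`, the others at most `e` each.
  K : ℕ → ℕ → ℕ
  K e j = D * e ∸ (D * j ∸ b)

  forward-degree : Fin n → ℕ
  forward-degree y = ∑ (allFin n) (λ x → 𝟙 (any? (λ g → g zero Fin.≟ y) (links x)))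

  ∑-forward-degree : ∑ (allFin n) forward-degree ≤ D * n
  ∑-forward-degree = begin
    ∑ (allFin n) forward-degree
      ≡⟨ ∑-swap (allFin n) (allFin n) (λ y x → 𝟙 (any? (λ g → g zero Fin.≟ y) (links x))) ⟩
    ∑ (allFin n) (λ x → ∑ (allFin n) (λ y → 𝟙 (any? (λ g → g zero Fin.≟ y) (links x))))
      ≤⟨ ∑-≤ (allFin n) (λ x _ → ≤-trans (per-vertex (links x)) (links≤D x)) ⟩
    length (allFin n) * D
      ≡⟨ trans (cong (_* D) (length-tabulate {n = n} id)) (*-comm n D) ⟩
    D * n ∎
    where
    open ≤-Reasoning
    per-vertex : ∀ l → ∑ (allFin n) (λ y → 𝟙 (any? (λ g → g zero Fin.≟ y) l)) ≤ length l
    per-vertex l = begin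
      ∑ (allFin n) (λ y → 𝟙 (any? (λ g → g zero Fin.≟ y) l))       ≤⟨ ∑-mono (allFin n) (λ y → 𝟙-any-≤ (λ g → g zero Fin.≟ y) l) ⟩
      ∑ (allFin n) (λ y → ∑ l (λ g → 𝟙 (g zero Fin.≟ y)))          ≡⟨ ∑-swap (allFin n) l _ ⟩
      ∑ l (λ g → ∑ (allFin n) (λ y → 𝟙 (g zero Fin.≟ y)))          ≤⟨ ∑-≤ l (λ g _ → allFin-once n (g zero)) ⟩
      length l * 1                                                 ≡⟨ *-identityʳ (length l) ⟩
      length l                                                     ∎

  -- Level 0 is a fallback open to every degree. This does no harm, since links that start in level
  -- 0 have `t ≥ k₀` and are accepted by every vertex.
  highest : ℕ → ℕ → ℕ
  highest d zero    = zero
  highest d (suc e) with d ≤? 2 ^ (D * (k₀ ∸ suc e))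
  ... | yes _ = suc e
  ... | no _  = highest d e

  highest≤ : ∀ d e → highest d e ≤ e
  highest≤ d zero    = z≤n
  highest≤ d (suc e) with d ≤? 2 ^ (D * (k₀ ∸ suc e))
  ... | yes _ = ≤-refl
  ... | no _  = m≤n⇒m≤1+n (highest≤ d e)

  highest-suitable : ∀ d e → 0 < highest d e → d ≤ 2 ^ (D * (k₀ ∸ highest d e))
  highest-suitable d (suc e) h>0 with d ≤? 2 ^ (D * (k₀ ∸ suc e))
  ... | yes p = p
  ... | no _  = highest-suitable d e h>0

  highest-maximal : ∀ d e → highest d e < e → 2 ^ (D * (k₀ ∸ suc (highest d e))) < d
  highest-maximal d (suc e) h<e with d ≤? 2 ^ (D * (k₀ ∸ suc e))
  ... | yes p = contradiction h<e (<-irrefl refl)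
  ... | no ¬p with highest d e ≟ e
  ...   | yes eq = subst (λ z → 2 ^ (D * (k₀ ∸ suc z)) < d) (sym eq) (≰⇒> ¬p)
  ...   | no neq = highest-maximal d e (≤∧≢⇒< (highest≤ d e) neq)

  st : Fin n → ℕ
  st x = highest (forward-degree x) k₀

  starts : ℕ → ℕ
  starts e = ∑ (allFin n) (λ x → 𝟙 (st x ≟ e))

  -- A vertex that starts at `e < k₀` was refused at `e + 1`, so its forward degree exceeds
  -- `2 ^ (D * (k₀ ∸ suc e))`, and all forward degrees together are at most `D * n`.
  starts-bound : ∀ e → e < k₀ → starts e * 2 ^ (D * (k₀ ∸ suc e)) ≤ D * n
  starts-bound e e<k₀ = begin
    starts e * 2 ^ (D * (k₀ ∸ suc e))                              ≡⟨ sym (∑-*ʳ (allFin n) (λ x → 𝟙 (st x ≟ e)) _) ⟩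
    ∑ (allFin n) (λ x → 𝟙 (st x ≟ e) * 2 ^ (D * (k₀ ∸ suc e)))     ≤⟨ ∑-mono (allFin n) (λ x → pointwise x (st x ≟ e)) ⟩
    ∑ (allFin n) forward-degree                                    ≤⟨ ∑-forward-degree ⟩
    D * n                                                          ∎
    where
    open ≤-Reasoning
    pointwise : ∀ x (p : Dec (st x ≡ e)) → 𝟙 p * 2 ^ (D * (k₀ ∸ suc e)) ≤ forward-degree x
    pointwise x (no _)     = z≤n
    pointwise x (yes refl) = ≤-trans (≤-reflexive (+-identityʳ _)) (<⇒≤ (highest-maximal (forward-degree x) k₀ e<k₀))

  -- `N e` is to bound the vertices of `H` that ever try level `e`. By `hits`, a family of disjoint
  -- link sets is accepted by too many vertices for all of them to be in use. `N-recursion` leaves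
  -- room for those that start at `e` and those that fail at `e + 1`.
  module Online
    {Acc : Fin m → Fin L → Set} (Acc? : ∀ v c → Dec (Acc v c))
    (capped-accepts : ∀ v c → lev v ≤ t c → Acc v c)
    (N M : ℕ → ℕ) (N<M : ∀ e → N e < M e) (M≤level : ∀ e → e ≤ k₀ → M e ≤ ∑ (allFin m) (λ v → 𝟙 (lev v ≟ e)))
    (hits : ∀ e j F → e ≤ k₀ → j ≤ k₀ → length F ≡ 2 ^ K e j → All (λ S → length S ≡ D) F →
            All (λ S → ∑ S (λ c → e ∸ t c) ≤ K e j) F →
            AllPairs (λ S S′ → ∀ c → c ∈ S → c ∈ S′ → e ≤ t c) F →
            N e < ∑ (allFin m) (λ v → 𝟙 ((lev v ≟ e) ×-dec any? (all? (Acc? v)) F)))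
    (n≤N : n ≤ N k₀)
    (N-recursion : ∀ e → e < k₀ → starts e + 2 ^ b * (D * 2 ^ (b + D * suc e)) ≤ N e)
    where

    codes : (Fin n → Fin m) → Fin n → List (Fin L)
    codes f x = map (λ g → code (f ∘ g)) (links x)

    -- f is total, but only its values on the vertices before s are meaningful.
    record Partial (s : ℕ) : Set where
      field
        f         : Fin n → Fin m
        injective : ∀ x y → toℕ x < s → toℕ y < s → f x ≡ f y → x ≡ y
        accepted  : ∀ x → toℕ x < s → All (Acc (f x)) (codes f x)
        low       : ∀ x → toℕ x < s → lev (f x) ≤ st x
        -- The trace of the greedy choice: a higher vertex suitable for `x` was passed over only
        -- because it was in use.
        blocked   : ∀ x → toℕ x < s → ∀ v → lev (f x) < lev v → lev v ≤ st x → All (Acc v) (codes f x) →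
                    ∃ λ y → toℕ y < s × f y ≡ v

    module Counting {s : ℕ} (φ : Partial s) where
      open Partial φ

      -- The search for the image of `x` descends from `st x` to `lev (f x)`: it attempts every
      -- level in between and fails at all but the last.
      Attempt Fail : ℕ → Fin n → Set
      Attempt e x = toℕ x < s × lev (f x) ≤ e × e ≤ st x
      Fail    e x = toℕ x < s × lev (f x) < e × e ≤ st x

      attempt? : ∀ e x → Dec (Attempt e x)
      attempt? e x = toℕ x <? s ×-dec lev (f x) ≤? e ×-dec e ≤? st x

      fail? : ∀ e x → Dec (Fail e x)
      fail? e x = toℕ x <? s ×-dec lev (f x) <? e ×-dec e ≤? st x

      attempts fails : ℕ → ℕ
      attempts e = ∑ (allFin n) (𝟙 ∘ attempt? e)
      fails    e = ∑ (allFin n) (𝟙 ∘ fail? e)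

      used-≤-attempts : ∀ e {P : Fin m → Set} (P? : ∀ v → Dec (P v)) →
        (∀ v → P v → lev v ≡ e × ∃ λ y → toℕ y < s × f y ≡ v) → ∑ (allFin m) (𝟙 ∘ P?) ≤ attempts e
      used-≤-attempts e P? used = count-cover (allFin m) (allFin n) P? (attempt? e) f Fin._≟_ (allFin-once m) preimage
        where
        preimage : ∀ v → _ → ∃ λ y → y ∈ allFin n × Attempt e y × f y ≡ v
        preimage v p with used v p
        ... | refl , y , y<s , refl = y , ∈-allFin y , (y<s , ≤-refl , low y y<s) , refl

      Type : ℕ → ℕ → Fin n → Set
      Type e j x = Any (λ c → t c < e × τ c ≡ j) (codes f x) × All (λ c → t c < e → τ c ≤ j) (codes f x)

      type? : ∀ e j x → Dec (Type e j x)
      type? e j x = any? (λ c → t c <? e ×-dec τ c ≟ j) (codes f x) ×-dec all? (λ c → (t c <? e) →-dec (τ c ≤? j)) (codes f x)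

      Conflict : ℕ → Fin n → Fin n → Set
      Conflict e x y = Any (λ c → t c < e × c ∈ codes f y) (codes f x)

      conflict? : ∀ e x y → Dec (Conflict e x y)
      conflict? e x y = any? (λ c → t c <? e ×-dec _∈?_ Fin._≟_ c (codes f y)) (codes f x)

      -- The image of the first entry `y` has positive level, since otherwise the link would be
      -- automatic at `e`. So the fallback is excluded and the degree condition holds at `st y`,
      -- which is at least the level of `f y`.
      degree-bound : ∀ e x g → e ≤ k₀ → toℕ x < s → g ∈ links x → t (code (f ∘ g)) < e →
        forward-degree (g zero) ≤ 2 ^ (D * τ (code (f ∘ g)))
      degree-bound e x g e≤k₀ x<s g∈ t<e = ≤-trans (highest-suitable _ k₀ (≤-trans lev>0 lev≤st))
          (^-monoʳ-≤ 2 (*-monoʳ-≤ D (∸-monoʳ-≤ k₀ (≤-trans (≤-reflexive lev-first) lev≤st))))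
        where
        y = g zero
        lev-first : lev (first (code (f ∘ g))) ≡ lev (f y)
        lev-first = cong lev (first-code (f ∘ g))
        lev≤st : lev (f y) ≤ st y
        lev≤st = low y (<-trans (backward x g g∈ zero) x<s)
        lev>0 : 0 < lev (f y)
        lev>0 = n≢0⇒n>0 (λ lev≡0 → <⇒≱ t<e (≤-trans e≤k₀ (≤-trans k₀≤Dk₀∸b
          (≤-reflexive (cong (λ z → D * (k₀ ∸ z) ∸ b) (sym (trans lev-first lev≡0)))))))

      -- A shared link determines its first entry in `H`, because `f` is injective on placed
      -- vertices, so `y` is counted in the forward degree of that entry. Each relevant link of `x`
      -- has `τ ≤ j`. The comparison of sums says that `X` is a sublist of `allFin n` as far as
      -- counting goes.
      few-conflicts : ∀ e j x (X : List (Fin n)) → e ≤ k₀ → toℕ x < s → Type e j x → (∀ y → y ∈ X → toℕ y < s) →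
        (∀ f′ → ∑ X f′ ≤ ∑ (allFin n) f′) →
        ∑ X (λ y → 𝟙 (conflict? e x y)) ≤ D * 2 ^ (D * j)
      few-conflicts e j x X e≤k₀ x<s (_ , τ≤j) X<s X⊆ = begin
        ∑ X (λ y → 𝟙 (conflict? e x y))
          ≤⟨ ∑-mono X (λ y → 𝟙-any-≤ (λ c → shared? c y) (codes f x)) ⟩
        ∑ X (λ y → ∑ (codes f x) (λ c → 𝟙 (shared? c y)))
          ≡⟨ ∑-swap X (codes f x) _ ⟩
        ∑ (codes f x) (λ c → ∑ X (λ y → 𝟙 (shared? c y)))
          ≤⟨ ∑-≤ (codes f x) per-link ⟩
        length (codes f x) * 2 ^ (D * j)
          ≤⟨ *-monoˡ-≤ (2 ^ (D * j)) (≤-trans (≤-reflexive (length-map _ (links x))) (links≤D x)) ⟩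
        D * 2 ^ (D * j) ∎
        where
        open ≤-Reasoning
        shared? : ∀ c y → Dec (t c < e × c ∈ codes f y)
        shared? c y = t c <? e ×-dec _∈?_ Fin._≟_ c (codes f y)
        per-link : ∀ c → c ∈ codes f x → ∑ X (λ y → 𝟙 (shared? c y)) ≤ 2 ^ (D * j)
        per-link c c∈ with t c <? e | ∈-map⁻ (λ g → code (f ∘ g)) c∈
        ... | no ¬t<e | _ = ≤-trans (∑-≤ X {c = 0} (λ y _ → 𝟙-≤ (shared? c y) (λ (t<e , _) → contradiction t<e ¬t<e)))
                            (≤-trans (≤-reflexive (*-zeroʳ (length X))) z≤n)
        ... | yes t<e | g , g∈ , refl = begin
          ∑ X (λ y → 𝟙 (shared? (code (f ∘ g)) y))
            ≤⟨ ∑-mono-∈ X (λ y y∈ → 𝟙-mono (shared? (code (f ∘ g)) y) (any? (λ g′ → g′ zero Fin.≟ g zero) (links y)) (λ { (_ , c∈y) → same-first y y∈ c∈y })) ⟩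
          ∑ X (λ y → 𝟙 (any? (λ g′ → g′ zero Fin.≟ g zero) (links y)))
            ≤⟨ X⊆ _ ⟩
          forward-degree (g zero)
            ≤⟨ degree-bound e x g e≤k₀ x<s g∈ t<e ⟩
          2 ^ (D * τ (code (f ∘ g)))
            ≤⟨ ^-monoʳ-≤ 2 (*-monoʳ-≤ D (All.lookup τ≤j c∈ t<e)) ⟩
          2 ^ (D * j) ∎
          where
          same-first : ∀ y → y ∈ X → code (f ∘ g) ∈ codes f y → Any (λ g′ → g′ zero ≡ g zero) (links y)
          same-first y y∈ c∈y with ∈-map⁻ (λ g → code (f ∘ g)) c∈y
          ... | g′ , g′∈ , eq = Any.map (λ { refl → injective (g′ zero) (g zero)
                  (<-trans (backward y g′ g′∈ zero) (X<s y y∈)) (<-trans (backward x g g∈ zero) x<s)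
                  (trans (sym (first-code (f ∘ g′))) (trans (cong first (sym eq)) (first-code (f ∘ g)))) }) g′∈

      -- Otherwise `greedy-independent` finds `2 ^ K e j` disjoint link sets among the failing
      -- vertices. More than `N e` vertices of level `e` accept one of them, and `blocked` makes
      -- each of these a used vertex, although at most `N e` are used.
      fails-of-type : ∀ e j → e ≤ k₀ → j ≤ k₀ → attempts e ≤ N e →
        ∑ (allFin n) (λ x → 𝟙 (fail? e x ×-dec type? e j x)) ≤ D * 2 ^ (b + D * e)
      fails-of-type e j e≤k₀ j≤k₀ few = ≮⇒≥ absurd
        where
        open ≤-Reasoning
        ft? : ∀ x → Dec (Fail e x × Type e j x)
        ft? x = fail? e x ×-dec type? e j x
        X : List (Fin n)
        X = filter ft? (allFin n)
        X-ft : ∀ x → x ∈ X → Fail e x × Type e j x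
        X-ft x x∈ = proj₂ (∈-filter⁻ ft? {xs = allFin n} x∈)
        Δ : ℕ
        Δ = D * 2 ^ (D * j)
        Δ>0 : 0 < Δ
        Δ>0 = *-mono-≤ D>0 (m^n>0 2 (D * j))
        conflicts : ∀ x → x ∈ X → ∑ X (λ y → 𝟙 (conflict? e x y)) ≤ Δ
        conflicts x x∈ = few-conflicts e j x X e≤k₀ (proj₁ (proj₁ (X-ft x x∈))) (proj₂ (X-ft x x∈))
          (λ y y∈ → proj₁ (proj₁ (X-ft y y∈))) (∑-filter-≤ ft? (allFin n))
        witness : ∀ x → x ∈ X → ∃ λ c → c ∈ codes f x × t c < e × τ c ≡ j
        witness x x∈ = Any→∃ (proj₁ (proj₂ (X-ft x x∈)))
          where
          Any→∃ : ∀ {l} → Any (λ c → t c < e × τ c ≡ j) l → ∃ λ c → c ∈ l × t c < e × τ c ≡ j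
          Any→∃ (here p)  = _ , here refl , p
          Any→∃ (there p) = let (c , c∈ , q) = Any→∃ p in c , there c∈ , q
        S : Fin n → List (Fin L)
        S x = pad D (codes f x)
        len-codes : ∀ x → length (codes f x) ≤ D
        len-codes x = ≤-trans (≤-reflexive (length-map _ (links x))) (links≤D x)
        S-length : ∀ x → x ∈ X → length (S x) ≡ D
        S-length x x∈ = length-pad D (codes f x) (proj₁ (proj₂ (witness x x∈))) (len-codes x)
        S-κ : ∀ x → x ∈ X → ∑ (S x) (λ c → e ∸ t c) ≤ K e j
        S-κ x x∈ with witness x x∈
        ... | c , c∈ , t<e , refl = m+n≤o⇒m≤o∸n _ (+-cancelʳ-≤ (e ∸ t c) _ _ (begin
          ∑ (S x) k′ + t c + (e ∸ t c)     ≡⟨ trans (+-assoc (∑ (S x) k′) _ _) (cong (∑ (S x) k′ +_) (m+[n∸m]≡n (<⇒≤ t<e))) ⟩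
          ∑ (S x) k′ + e                   ≤⟨ ∑-one-smaller (S x) k′ e (λ c → m∸n≤m e (t c)) (∈-pad⁺ D c∈) ⟩
          length (S x) * e + (e ∸ t c)     ≡⟨ cong (λ z → z * e + (e ∸ t c)) (S-length x x∈) ⟩
          D * e + (e ∸ t c)                ∎))
          where
          k′ : Fin L → ℕ
          k′ c = e ∸ t c
        S-disjoint : ∀ {x y} → ¬ Conflict e x y → ∀ c → c ∈ S x → c ∈ S y → e ≤ t c
        S-disjoint ¬conf c c∈x c∈y = ≮⇒≥ (λ t<e → ¬conf (Any.map (λ { refl → t<e , ∈-pad⁻ D c∈y }) (∈-pad⁻ D c∈x)))
        Hit : List (Fin n) → Fin m → Set
        Hit ys v = lev v ≡ e × Any (All (Acc v)) (map S ys)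
        hit-used : ∀ ys → All (_∈ X) ys → ∀ v → Hit ys v → lev v ≡ e × ∃ λ y → toℕ y < s × f y ≡ v
        hit-used ys ys∈ v (refl , hit) = refl , go ys ys∈ hit
          where
          go : ∀ ys → All (_∈ X) ys → Any (All (Acc v)) (map S ys) → ∃ λ y → toℕ y < s × f y ≡ v
          go (x ∷ ys) (x∈ ∷ _) (here acc) =
            let ((x<s , lev<e , e≤st) , _) = X-ft x x∈ in
            blocked x x<s v lev<e e≤st (All.tabulate (λ c∈ → All.lookup acc (∈-pad⁺ D c∈)))
          go (x ∷ ys) (_ ∷ ys∈) (there h) = go ys ys∈ h
        -- The conflict degree times the number of sets wanted is bounded independently of `j`: the
        -- exponent `D * j` cancels against `K e j` up to the shift `b`.
        size : ∀ x → x ∈ X → Δ * 2 ^ K e j ≤ D * 2 ^ (b + D * e)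
        size x x∈ with witness x x∈
        ... | c , _ , t<e , refl = begin
          D * 2 ^ (D * τ c) * 2 ^ K e (τ c)       ≡⟨ *-assoc D _ _ ⟩
          D * (2 ^ (D * τ c) * 2 ^ K e (τ c))     ≡⟨ cong (D *_) (sym (^-distribˡ-+-* 2 (D * τ c) (K e (τ c)))) ⟩
          D * 2 ^ (D * τ c + K e (τ c))           ≤⟨ *-monoʳ-≤ D (^-monoʳ-≤ 2 (begin
            D * τ c + K e (τ c)                     ≤⟨ +-monoˡ-≤ (K e (τ c)) (m≤n+m∸n (D * τ c) b) ⟩
            b + t c + K e (τ c)                     ≡⟨ +-assoc b (t c) _ ⟩
            b + (t c + K e (τ c))                   ≡⟨ cong (b +_) (m+[n∸m]≡n (≤-trans (<⇒≤ t<e) (m≤n*m e D {{>-nonZero D>0}}))) ⟩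
            b + D * e                               ∎)) ⟩
          D * 2 ^ (b + D * e)                     ∎
        absurd : ¬ (D * 2 ^ (b + D * e) < ∑ (allFin n) (λ x → 𝟙 (ft? x)))
        absurd large = go X refl
          where
          large′ : D * 2 ^ (b + D * e) < length X
          large′ = ≤-trans large (≤-reflexive (sym (length-filter-∑ ft? (allFin n))))
          go : ∀ Y → X ≡ Y → ⊥
          go [] eq = contradiction (subst (λ z → D * 2 ^ (b + D * e) < length z) eq large′) λ ()
          go (x ∷ _) eq with greedy-independent (conflict? e) Δ Δ>0 (2 ^ K e j) X conflicts
                               (≤-trans (size x (subst (x ∈_) (sym eq) (here refl))) (<⇒≤ large′))
          ... | ys , len , ys∈ , indep = <⇒≱ (hits e j (map S ys) e≤k₀ j≤k₀ (trans (length-map S ys) len)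
                  (All.map⁺ (All.map (S-length _) ys∈)) (All.map⁺ (All.map (S-κ _) ys∈))
                  (AllPairs.map⁺ (AllPairs.map S-disjoint indep)))
                (≤-trans (used-≤-attempts e (λ v → (lev v ≟ e) ×-dec any? (all? (Acc? v)) (map S ys)) (hit-used ys ys∈)) few)

      -- If every link were automatic at `e`, all vertices of level `e` would accept them and by
      -- `blocked` all would be used, but there are at least `M e > N e` of them. `j` is the largest
      -- `τ` among the links that are not automatic.
      fail-has-type : ∀ e x → e ≤ k₀ → attempts e ≤ N e → Fail e x → ∃ λ j → j ≤ k₀ × Type e j x
      fail-has-type e x e≤k₀ few (x<s , lev<e , e≤st) with any? (λ c → t c <? e) (codes f x)
      ... | yes some =
        let (c , c∈ , t<e , cmax) = maximal-element (λ c → t c <? e) τ (codes f x) some in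
        τ c , m∸n≤m k₀ (lev (first c)) , Any.map (λ { refl → t<e , refl }) c∈ , All.tabulate (λ {d} d∈ → cmax d d∈)
      ... | no none = contradiction (≤-trans (M≤level e e≤k₀) (≤-trans (used-≤-attempts e (λ v → lev v ≟ e) used) few)) (<⇒≱ (N<M e))
        where
        used : ∀ v → lev v ≡ e → lev v ≡ e × ∃ λ y → toℕ y < s × f y ≡ v
        used v refl = refl , blocked x x<s v lev<e e≤st (All.tabulate (λ {c} c∈ →
          capped-accepts v c (≮⇒≥ (λ t<e → none (Any.map (λ { refl → t<e }) c∈)))))

      -- There are at most `2 ^ b` types; this is the second factor `2 ^ b`, besides the one inside
      -- `fails-of-type`.
      fails-bound : ∀ e → e ≤ k₀ → attempts e ≤ N e → fails e ≤ 2 ^ b * (D * 2 ^ (b + D * e))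
      fails-bound e e≤k₀ few = begin
        fails e
          ≤⟨ ∑-mono (allFin n) (λ x → 𝟙-≤ (fail? e x) (λ fl → let (j , j≤ , ty) = fail-has-type e x e≤k₀ few fl in
               ≤-trans (≤-reflexive (sym (𝟙-true (fail? e x ×-dec type? e j x) (fl , ty))))
                       (∑-∈ (λ j → 𝟙 (fail? e x ×-dec type? e j x)) (∈-upTo⁺ (s≤s j≤))))) ⟩
        ∑ (allFin n) (λ x → ∑ (upTo (suc k₀)) (λ j → 𝟙 (fail? e x ×-dec type? e j x)))
          ≡⟨ ∑-swap (allFin n) (upTo (suc k₀)) _ ⟩
        ∑ (upTo (suc k₀)) (λ j → ∑ (allFin n) (λ x → 𝟙 (fail? e x ×-dec type? e j x)))
          ≤⟨ ∑-≤ (upTo (suc k₀)) (λ j j∈ → fails-of-type e j e≤k₀ (s≤s⁻¹ (∈-upTo⁻ j∈)) few) ⟩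
        length (upTo (suc k₀)) * (D * 2 ^ (b + D * e))
          ≤⟨ *-monoˡ-≤ _ (≤-trans (≤-reflexive (length-upTo (suc k₀))) 1+k₀≤2^b) ⟩
        2 ^ b * (D * 2 ^ (b + D * e)) ∎
        where open ≤-Reasoning

      -- Induction from the top level downwards, with `i = k₀ − e`. An attempt at `e` either starts
      -- there or comes from a failure at `e + 1`.
      attempts-bound : ∀ i e → i + e ≡ k₀ → attempts e ≤ N e
      attempts-bound zero e refl = begin
        attempts e              ≤⟨ ∑-mono (allFin n) (λ x → 𝟙-≤ (attempt? e x) (λ _ → ≤-refl)) ⟩
        ∑ (allFin n) (const 1)  ≡⟨ trans (∑-length (allFin n)) (length-tabulate {n = n} id) ⟩
        n                       ≤⟨ n≤N ⟩
        N e                     ∎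
        where open ≤-Reasoning
      attempts-bound (suc i) e eq = begin
        attempts e                                             ≤⟨ ∑-mono (allFin n) pointwise ⟩
        ∑ (allFin n) (λ x → 𝟙 (st x ≟ e) + 𝟙 (fail? (suc e) x))  ≡⟨ ∑-+ (allFin n) (λ x → 𝟙 (st x ≟ e)) (𝟙 ∘ fail? (suc e)) ⟩
        starts e + fails (suc e)                               ≤⟨ +-monoʳ-≤ (starts e) (fails-bound (suc e) e<k₀ (attempts-bound i (suc e) (trans (+-suc i e) eq))) ⟩
        starts e + 2 ^ b * (D * 2 ^ (b + D * suc e))           ≤⟨ N-recursion e e<k₀ ⟩
        N e                                                    ∎
        where
        open ≤-Reasoning
        e<k₀ : e < k₀
        e<k₀ = ≤-trans (s≤s (m≤n+m e i)) (≤-reflexive eq)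
        pointwise : ∀ x → 𝟙 (attempt? e x) ≤ 𝟙 (st x ≟ e) + 𝟙 (fail? (suc e) x)
        pointwise x = 𝟙-≤ (attempt? e x) (λ (x<s , lev≤e , e≤st) → cases x<s lev≤e e≤st (st x ≟ e))
          where
          cases : toℕ x < s → lev (f x) ≤ e → e ≤ st x → (p : Dec (st x ≡ e)) → 1 ≤ 𝟙 p + 𝟙 (fail? (suc e) x)
          cases _   _     _    (yes _) = s≤s z≤n
          cases x<s lev≤e e≤st (no ¬p) = ≤-reflexive (sym (𝟙-true (fail? (suc e) x) (x<s , s≤s lev≤e , ≤∧≢⇒< e≤st (¬p ∘ sym))))

    start : Fin m → Partial 0
    start v = record
      { f = λ _ → v ; injective = λ _ _ () ; accepted = λ _ () ; low = λ _ () ; blocked = λ _ () }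

    extend : ∀ (x : Fin n) → Partial (toℕ x) → Partial (suc (toℕ x))
    extend x φ = record
      { f = f′ ; injective = injective′ ; accepted = accepted′ ; low = low′ ; blocked = blocked′ }
      where
      open Partial φ
      open Counting φ
      Used : Fin m → Set
      Used v = ∃ λ y → toℕ y < toℕ x × f y ≡ v
      used? : ∀ v → Dec (Used v)
      used? v = Fin.any? (λ y → toℕ y <? toℕ x ×-dec f y Fin.≟ v)
      Good : Fin m → Set
      Good v = ¬ Used v × All (Acc v) (codes f x) × lev v ≤ st x
      good? : ∀ v → Dec (Good v)
      good? v = ¬? (used? v) ×-dec all? (Acc? v) (codes f x) ×-dec lev v ≤? st x
      exists-good : ∃ Good
      exists-good with Fin.any? good?
      ... | yes g   = g
      ... | no none = contradiction
          (≤-trans (M≤level 0 z≤n) (≤-trans (used-≤-attempts 0 (λ v → lev v ≟ 0) all-used) (attempts-bound k₀ 0 (+-identityʳ k₀)))) (<⇒≱ (N<M 0))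
        where
        all-used : ∀ v → lev v ≡ 0 → lev v ≡ 0 × Used v
        all-used v lev≡0 with used? v
        ... | yes u = lev≡0 , u
        ... | no ¬u = contradiction (v , ¬u ,
                All.tabulate (λ {c} _ → capped-accepts v c (≤-trans (≤-reflexive lev≡0) z≤n)) ,
                ≤-trans (≤-reflexive lev≡0) z≤n) none
      best = argmax good? lev k₀ (λ v _ → lev≤k₀ v) exists-good
      v = proj₁ best
      v-good : Good v
      v-good = proj₁ (proj₂ best)
      f′ : Fin n → Fin m
      f′ y = if does (y Fin.≟ x) then v else f y
      f′-new : f′ x ≡ v
      f′-new with x Fin.≟ x
      ... | yes _ = refl
      ... | no ¬p = contradiction refl ¬p
      f′-old : ∀ y → toℕ y < toℕ x → f′ y ≡ f y
      f′-old y y<x with y Fin.≟ x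
      ... | yes refl = contradiction y<x (<-irrefl refl)
      ... | no _     = refl
      codes-same : ∀ y → toℕ y ≤ toℕ x → codes f′ y ≡ codes f y
      codes-same y y≤x = map-cong-local (All.tabulate (λ {g} g∈ →
        code-cong (f′ ∘ g) (f ∘ g) (λ i → f′-old (g i) (<-≤-trans (backward y g g∈ i) y≤x))))
      case-≤ : ∀ {P : Fin n → Set} → (∀ y → toℕ y < toℕ x → P y) → P x → ∀ y → toℕ y < suc (toℕ x) → P y
      case-≤ {P} old new y (s≤s y≤x) with toℕ y ≟ toℕ x
      ... | yes eq = subst P (Fin.toℕ-injective (sym eq)) new
      ... | no neq = old y (≤∧≢⇒< y≤x neq)
      fresh : ∀ y → toℕ y < toℕ x → f′ y ≢ f′ x
      fresh y y<x eq = proj₁ v-good (y , y<x , trans (sym (f′-old y y<x)) (trans eq f′-new))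
      injective′ : ∀ y z → toℕ y < suc (toℕ x) → toℕ z < suc (toℕ x) → f′ y ≡ f′ z → y ≡ z
      injective′ y z y< z< = case-≤ {λ y → f′ y ≡ f′ z → y ≡ z}
        (λ y y<x → case-≤ {λ z → f′ y ≡ f′ z → y ≡ z}
          (λ z z<x eq → injective y z y<x z<x (trans (sym (f′-old y y<x)) (trans eq (f′-old z z<x))))
          (λ eq → contradiction eq (fresh y y<x)) z z<)
        (case-≤ {λ z → f′ x ≡ f′ z → x ≡ z} (λ z z<x eq → contradiction (sym eq) (fresh z z<x)) (λ _ → refl) z z<) y y<
      accepted′ : ∀ y → toℕ y < suc (toℕ x) → All (Acc (f′ y)) (codes f′ y)
      accepted′ = case-≤
        (λ y y<x → subst₂ (λ w l → All (Acc w) l) (sym (f′-old y y<x)) (sym (codes-same y (<⇒≤ y<x))) (accepted y y<x))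
        (subst₂ (λ w l → All (Acc w) l) (sym f′-new) (sym (codes-same x ≤-refl)) (proj₁ (proj₂ v-good)))
      low′ : ∀ y → toℕ y < suc (toℕ x) → lev (f′ y) ≤ st y
      low′ = case-≤
        (λ y y<x → subst (λ w → lev w ≤ st y) (sym (f′-old y y<x)) (low y y<x))
        (subst (λ w → lev w ≤ st x) (sym f′-new) (proj₂ (proj₂ v-good)))
      lift : ∀ {w} → Used w → ∃ λ y → toℕ y < suc (toℕ x) × f′ y ≡ w
      lift (y , y<x , eq) = y , m≤n⇒m≤1+n y<x , trans (f′-old y y<x) eq
      blocked′ : ∀ y → toℕ y < suc (toℕ x) → ∀ w → lev (f′ y) < lev w → lev w ≤ st y → All (Acc w) (codes f′ y) →
                 ∃ λ z → toℕ z < suc (toℕ x) × f′ z ≡ w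
      blocked′ = case-≤
        (λ y y<x w lev< ≤st acc → lift (blocked y y<x w (subst (λ u → lev u < lev w) (f′-old y y<x) lev<) ≤st
          (subst (All (Acc w)) (codes-same y (<⇒≤ y<x)) acc)))
        (λ w lev< ≤st acc → lift (decidable-stable (used? w) (λ ¬u →
          <⇒≱ (subst (λ u → lev u < lev w) f′-new lev<)
              (proj₂ (proj₂ best) w (¬u , subst (All (Acc w)) (codes-same x ≤-refl) acc , ≤st)))))

    embed-prefix : Fin m → ∀ s → s ≤ n → Partial s
    embed-prefix v zero    _   = start v
    embed-prefix v (suc s) s<n = subst (Partial ∘ suc) (Fin.toℕ-fromℕ< s<n)
      (extend (fromℕ< s<n) (subst Partial (sym (Fin.toℕ-fromℕ< s<n)) (embed-prefix v s (<⇒≤ s<n))))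

    embedding : ∃ λ (f : Fin n → Fin m) → (∀ x y → f x ≡ f y → x ≡ y) ×
                (∀ x g → g ∈ links x → Acc (f x) (code (f ∘ g)))
    embedding = f , (λ x y → injective x y (Fin.toℕ<n x) (Fin.toℕ<n y)) ,
      λ x g g∈ → All.lookup (accepted x (Fin.toℕ<n x)) (∈-map⁺ (λ g → code (f ∘ g)) g∈)
      where
      vertex : Fin m
      vertex = allFin-inhabited m _ (≤-trans (m<n⇒0<n (N<M 0)) (M≤level 0 z≤n))
      open Partial (embed-prefix vertex n ≤-refl)

-- The random host

module Host
  (D k₀ m L : ℕ) (L>0 : 0 < L) (lev : Fin m → ℕ) (lev≤k₀ : ∀ v → lev v ≤ k₀)
  (t : Fin L → ℕ) (K : ℕ → ℕ → ℕ) (K≤De : ∀ e j → K e j ≤ D * e)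
  (N X : ℕ → ℕ)
  (level-size : ∀ e → e ≤ k₀ → ∑ (allFin m) (λ v → 𝟙 (lev v ≟ e)) ≡ 4 * X e)
  (union-bound : ∀ e → e ≤ k₀ → (1 + suc k₀ * (L ^ D) ^ (2 ^ (D * e))) * 4 ^ N e < 2 ^ X e)
  where

  -- `2 ^ e` times the expected number of links accepted in level `e` is the sum of `2 ^ (t c ⊓ e)`;
  -- dropping the cap gives one bound for all levels.
  weight : ℕ
  weight = ∑ (allFin L) (λ c → 2 ^ t c)

  weight>0 : 0 < weight
  weight>0 = ≤-trans (m^n>0 2 (t c₀)) (∑-∈ (λ c → 2 ^ t c) (∈-allFin c₀))
    where
    c₀ : Fin L
    c₀ = fromℕ< L>0

  module Level (e : ℕ) (e≤k₀ : e ≤ k₀) where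

    open Acceptance (2 ^ e) L (m^n>0 2 e) (λ c → 2 ^ (t c ⊓ e)) (λ c → e ∸ t c)
      (λ c → trans (sym (^-distribˡ-+-* 2 (t c ⊓ e) (e ∸ t c))) (cong (2 ^_) (m⊓n+n∸m≡n (t c) e))) public

    half? : ∀ F → Dec (2 * ∑ Ω (λ ω → 𝟙 (misses? F ω)) ≤ length Ω)
    half? F = 2 * ∑ Ω (λ ω → 𝟙 (misses? F ω)) ≤? length Ω

    of-type : ℕ → List (List (List (Fin L)))
    of-type j = lists (lists (allFin L) D) (2 ^ K e j)

    candidates : List (List (List (Fin L)))
    candidates = concatMap of-type (upTo (suc k₀))

    -- Filtering by the conclusion of misses-half makes it unnecessary to decide disjointness.
    𝔽 : List (List (List (Fin L)))
    𝔽 = filter half? candidates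

    length-𝔽 : length 𝔽 ≤ suc k₀ * (L ^ D) ^ (2 ^ (D * e))
    length-𝔽 = begin
      length 𝔽                     ≤⟨ length-filter half? candidates ⟩
      length candidates            ≡⟨ sym (∑-length candidates) ⟩
      ∑ candidates (const 1)       ≡⟨ ∑-concatMap of-type (upTo (suc k₀)) (const 1) ⟩
      ∑ (upTo (suc k₀)) (λ j → ∑ (lists (lists (allFin L) D) (2 ^ K e j)) (const 1))
                                   ≤⟨ ∑-≤ (upTo (suc k₀)) (λ j _ → begin
           ∑ (lists (lists (allFin L) D) (2 ^ K e j)) (const 1)  ≡⟨ ∑-length (lists (lists (allFin L) D) (2 ^ K e j)) ⟩
           length (lists (lists (allFin L) D) (2 ^ K e j))       ≡⟨ length-lists (lists (allFin L) D) (2 ^ K e j) ⟩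
           length (lists (allFin L) D) ^ (2 ^ K e j)             ≡⟨ cong (_^ (2 ^ K e j)) (trans (length-lists (allFin L) D) (cong (_^ D) (length-tabulate {n = L} id))) ⟩
           (L ^ D) ^ (2 ^ K e j)                                 ≤⟨ ^-monoʳ-≤ (L ^ D) {{m^n≢0 L D {{>-nonZero L>0}}}} (^-monoʳ-≤ 2 (K≤De e j)) ⟩
           (L ^ D) ^ (2 ^ (D * e))                               ∎) ⟩
      length (upTo (suc k₀)) * (L ^ D) ^ (2 ^ (D * e))
                                   ≡⟨ cong (_* (L ^ D) ^ (2 ^ (D * e))) (length-upTo (suc k₀)) ⟩
      suc k₀ * (L ^ D) ^ (2 ^ (D * e)) ∎
      where open ≤-Reasoning

    cost : (Fin L → Fin (2 ^ e)) → ℕ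
    cost ω = 2 ^ e * ∑ (allFin L) (λ c → 𝟙 (accepts? ω c))

    cost-average : ∑ Ω cost ≤ length Ω * weight
    cost-average = begin
      ∑ Ω cost                                                        ≡⟨ ∑-*ˡ Ω (2 ^ e) _ ⟩
      2 ^ e * ∑ Ω (λ ω → ∑ (allFin L) (λ c → 𝟙 (accepts? ω c)))       ≡⟨ cong (2 ^ e *_) (∑-swap Ω (allFin L) _) ⟩
      2 ^ e * ∑ (allFin L) (λ c → ∑ Ω (λ ω → 𝟙 (accepts? ω c)))       ≡⟨ sym (∑-*ˡ (allFin L) (2 ^ e) _) ⟩
      ∑ (allFin L) (λ c → 2 ^ e * ∑ Ω (λ ω → 𝟙 (accepts? ω c)))
        ≤⟨ ∑-mono (allFin L) (λ c → ≤-trans (≤-reflexive (∑-accepts (2 ^ e) L c _ (thr≤Q c)))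
             (≤-trans (*-monoˡ-≤ (length Ω) (^-monoʳ-≤ 2 (m⊓n≤m (t c) e))) (≤-reflexive (*-comm (2 ^ t c) (length Ω))))) ⟩
      ∑ (allFin L) (λ c → length Ω * 2 ^ t c)                         ≡⟨ ∑-*ˡ (allFin L) (length Ω) _ ⟩
      length Ω * weight                                                    ∎
      where open ≤-Reasoning

    open Potential Ω (length-funs>0 (2 ^ e) L (m^n>0 2 e)) 𝔽 misses?
      (λ F F∈ → proj₂ (∈-filter⁻ half? {xs = candidates} F∈)) cost weight weight>0 cost-average

    chosen : ∃ λ (ωs : Fin m → Fin L → Fin (2 ^ e)) → (∀ v → cost (ωs v) ≤ 3 * weight) ×
      (∀ F → F ∈ 𝔽 → N e < ∑ (allFin m) (λ v → 𝟙 ((lev v ≟ e) ×-dec ¬? (misses? F (ωs v)))))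
    chosen = many-hits m (λ v → lev v ≟ e) (X e) (N e) (level-size e e≤k₀)
      (≤-<-trans (*-monoˡ-≤ (4 ^ N e) (s≤s length-𝔽)) (union-bound e e≤k₀))

    disjoint-family : ∀ j F → j ≤ k₀ → length F ≡ 2 ^ K e j → All (λ S → length S ≡ D) F →
      All (λ S → ∑ S (λ c → e ∸ t c) ≤ K e j) F →
      AllPairs (λ S S′ → ∀ c → c ∈ S → c ∈ S′ → e ≤ t c) F → F ∈ 𝔽
    disjoint-family j F j≤k₀ len lens κs disj = ∈-filter⁺ half?
      (∈-concatMap⁺ of-type (lose (∈-upTo⁺ (s≤s j≤k₀)) (subst (λ z → F ∈ lists (lists (allFin L) D) z) len
        (∈-lists (lists (allFin L) D) F (All.map (λ { {S} refl → ∈-lists (allFin L) S (All.tabulate (λ {c} _ → ∈-allFin c)) }) lens)))))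
      (misses-half F (K e j) len κs (AllPairs.map (λ h c c∈ c∈′ → cong (2 ^_) (m≥n⇒m⊓n≡n (h c c∈ c∈′))) disj))

  -- Every level selects labellings for all of `Fin m`; a vertex reads only the selection of its own
  -- level.
  label : ∀ v → Fin L → Fin (2 ^ lev v)
  label v = proj₁ (Level.chosen (lev v) (lev≤k₀ v)) v

  Acc : Fin m → Fin L → Set
  Acc v c = toℕ (label v c) < 2 ^ (t c ⊓ lev v)

  Acc? : ∀ v c → Dec (Acc v c)
  Acc? v c = toℕ (label v c) <? 2 ^ (t c ⊓ lev v)

  capped-accepts : ∀ v c → lev v ≤ t c → Acc v c
  capped-accepts v c lev≤t = subst (λ z → toℕ (label v c) < 2 ^ z) (sym (m≥n⇒m⊓n≡n lev≤t)) (Fin.toℕ<n (label v c))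

  cost-bound : ∀ v → 2 ^ lev v * ∑ (allFin L) (𝟙 ∘ Acc? v) ≤ 3 * weight
  cost-bound v = proj₁ (proj₂ (Level.chosen (lev v) (lev≤k₀ v))) v

  hits : ∀ e j F → e ≤ k₀ → j ≤ k₀ → length F ≡ 2 ^ K e j → All (λ S → length S ≡ D) F →
    All (λ S → ∑ S (λ c → e ∸ t c) ≤ K e j) F →
    AllPairs (λ S S′ → ∀ c → c ∈ S → c ∈ S′ → e ≤ t c) F →
    N e < ∑ (allFin m) (λ v → 𝟙 ((lev v ≟ e) ×-dec any? (all? (Acc? v)) F))
  hits e j F e≤k₀ j≤k₀ len lens κs disj = <-≤-trans
    (proj₂ (proj₂ chosen) F (disjoint-family j F j≤k₀ len lens κs disj))
    (∑-mono (allFin m) (λ v → 𝟙-mono ((lev v ≟ e) ×-dec ¬? (misses? F (proj₁ chosen v))) ((lev v ≟ e) ×-dec any? (all? (Acc? v)) F)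
      (λ { (refl , ¬miss) → refl , decidable-stable (any? (all? (Acc? v)) F) (λ ¬any → ¬miss (All.map (λ {S} ¬acc acc →
        -- `label` contains the proof `lev≤k₀ v`, the selection for `e` the proof `e≤k₀`; the two
        -- have to be identified.
        ¬acc (subst (λ p → All (λ c → toℕ (proj₁ (Level.chosen (lev v) p) v c) < 2 ^ (t c ⊓ lev v)) S) (≤-irrelevant e≤k₀ (lev≤k₀ v)) acc))
        (All.¬Any⇒All¬ F ¬any))) })))
    where open Level e e≤k₀

-- Hypergraphs and their back links

does-true : {P : Set} (d : Dec P) → does d ≡ true → P
does-true (yes p) _ = p

∑-cartesianProduct : (xs : List A) (ys : List B) (f : A × B → ℕ) →
  ∑ (cartesianProduct xs ys) f ≡ ∑ xs (λ x → ∑ ys (λ y → f (x , y)))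
∑-cartesianProduct []       ys f = refl
∑-cartesianProduct (x ∷ xs) ys f = trans (∑-++ (map (x ,_) ys) (cartesianProduct xs ys) f)
  (cong₂ _+_ (∑-map (x ,_) ys f) (∑-cartesianProduct xs ys f))

countB-∑ : (p : A → Bool) (xs : List A) → countB p xs ≡ ∑ xs (λ x → if p x then 1 else 0)
countB-∑ p []       = refl
countB-∑ p (x ∷ xs) = cong ((if p x then 1 else 0) +_) (countB-∑ p xs)

_≟ₛ_ : ∀ {n} → DecidableEquality (Subset n)
_≟ₛ_ = ≡-dec Bool._≟_

∈-allSubsets : ∀ {n} (e : Subset n) → e ∈ allSubsets n
∈-allSubsets []          = here refl
∈-allSubsets (true ∷ e)  = ∈-++⁺ˡ (∈-map⁺ (true ∷_) (∈-allSubsets e))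
∈-allSubsets (false ∷ e) = ∈-++⁺ʳ _ (∈-map⁺ (false ∷_) (∈-allSubsets e))

allSubsets-once : ∀ n (e : Subset n) → ∑ (allSubsets n) (λ e′ → 𝟙 (e ≟ₛ e′)) ≤ 1
allSubsets-once zero    []      = ≤-refl
allSubsets-once (suc n) (b ∷ e) = begin
  ∑ (allSubsets (suc n)) (λ e′ → 𝟙 ((b ∷ e) ≟ₛ e′))
    ≡⟨ trans (∑-++ (map (true ∷_) (allSubsets n)) (map (false ∷_) (allSubsets n)) _)
         (cong₂ _+_ (∑-map (true ∷_) (allSubsets n) _) (∑-map (false ∷_) (allSubsets n) _)) ⟩
  half true + half false   ≤⟨ one-half (b Bool.≟ true) ⟩
  1                        ∎
  where
  open ≤-Reasoning
  half : Bool → ℕ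
  half b′ = ∑ (allSubsets n) (λ e′ → 𝟙 ((b ∷ e) ≟ₛ (b′ ∷ e′)))
  same : ∀ b′ → half b′ ≤ 1
  same b′ = ≤-trans (∑-mono (allSubsets n) (λ e′ → 𝟙-mono ((b ∷ e) ≟ₛ (b′ ∷ e′)) (e ≟ₛ e′) ∷-injectiveʳ)) (allSubsets-once n e)
  different : ∀ b′ → b ≢ b′ → half b′ ≤ 0
  different b′ b≢b′ = ≤-trans (∑-≤ (allSubsets n) {c = 0} (λ e′ _ → 𝟙-≤ ((b ∷ e) ≟ₛ (b′ ∷ e′)) (λ eq → contradiction (∷-injectiveˡ eq) b≢b′)))
    (≤-reflexive (*-zeroʳ (length (allSubsets n))))
  one-half : Dec (b ≡ true) → half true + half false ≤ 1
  one-half (yes refl) = +-mono-≤ (same true) (different false λ ())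
  one-half (no b≢)    = +-mono-≤ (different true b≢) (same false)

∈-image⁻ : ∀ {n m} (f : Fin n → Fin m) (e : Subset n) {z} → z ∈ₛ image f e → ∃ λ x → x ∈ₛ e × f x ≡ z
∈-image⁻ f []          z∈ = contradiction z∈ ∉⊥
∈-image⁻ f (true ∷ e)  z∈ with x∈p∪q⁻ ⁅ f zero ⁆ (image (f ∘ suc) e) z∈
... | inj₁ z∈ˡ = zero , here , sym (x∈⁅y⁆⇒x≡y (f zero) z∈ˡ)
... | inj₂ z∈ʳ = let (x , x∈ , eq) = ∈-image⁻ (f ∘ suc) e z∈ʳ in suc x , there x∈ , eq
∈-image⁻ f (false ∷ e) z∈ with x∈p∪q⁻ Subset.⊥ (image (f ∘ suc) e) z∈
... | inj₁ z∈ˡ = contradiction z∈ˡ ∉⊥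
... | inj₂ z∈ʳ = let (x , x∈ , eq) = ∈-image⁻ (f ∘ suc) e z∈ʳ in suc x , there x∈ , eq

∈-image⁺ : ∀ {n m} (f : Fin n → Fin m) (e : Subset n) {x} → x ∈ₛ e → f x ∈ₛ image f e
∈-image⁺ f (true ∷ e) here       = x∈p∪q⁺ (inj₁ (x∈⁅x⁆ (f zero)))
∈-image⁺ f (b ∷ e)    (there x∈) = x∈p∪q⁺ {p = if b then ⁅ f zero ⁆ else Subset.⊥} (inj₂ (∈-image⁺ (f ∘ suc) e x∈))

∣⁅x⁆∪p∣ : ∀ {m} (x : Fin m) (p : Subset m) → x ∉ₛ p → ∣ ⁅ x ⁆ ∪ p ∣ ≡ suc ∣ p ∣
∣⁅x⁆∪p∣ zero    (true ∷ p)  x∉ = contradiction here x∉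
∣⁅x⁆∪p∣ zero    (false ∷ p) x∉ = cong (suc ∘ ∣_∣) (∪-identityˡ p)
∣⁅x⁆∪p∣ (suc x) (true ∷ p)  x∉ = cong suc (∣⁅x⁆∪p∣ x p (x∉ ∘ there))
∣⁅x⁆∪p∣ (suc x) (false ∷ p) x∉ = ∣⁅x⁆∪p∣ x p (x∉ ∘ there)

∣image∣ : ∀ {n m} (f : Fin n → Fin m) → Injective _≡_ _≡_ f → (e : Subset n) → ∣ image f e ∣ ≡ ∣ e ∣
∣image∣ {m = m} f inj [] = ∣⊥∣≡0 m
∣image∣ f inj (true ∷ e) = trans (∣⁅x⁆∪p∣ (f zero) (image (f ∘ suc) e) new) (cong suc (∣image∣ (f ∘ suc) (Fin.suc-injective ∘ inj) e))
  where
  new : f zero ∉ₛ image (f ∘ suc) e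
  new z∈ = let (x , _ , eq) = ∈-image⁻ (f ∘ suc) e z∈ in contradiction (inj eq) λ ()
∣image∣ f inj (false ∷ e) = trans (cong ∣_∣ (∪-identityˡ (image (f ∘ suc) e))) (∣image∣ (f ∘ suc) (Fin.suc-injective ∘ inj) e)

∣p∣≡1+∣p-x∣ : ∀ {n} {p : Subset n} {x} → x ∈ₛ p → ∣ p ∣ ≡ suc ∣ p - x ∣
∣p∣≡1+∣p-x∣ {p = true ∷ p} here = cong (suc ∘ ∣_∣) (sym (p─⊥≡p p))
∣p∣≡1+∣p-x∣ {p = true ∷ p}  (there x∈) = cong suc (∣p∣≡1+∣p-x∣ x∈)
∣p∣≡1+∣p-x∣ {p = false ∷ p} (there x∈) = ∣p∣≡1+∣p-x∣ x∈

x∉p-x : ∀ {n} (p : Subset n) (x : Fin n) → x ∉ₛ p - x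
x∉p-x (b ∷ p) (suc x) (there x∈) = x∉p-x p x x∈

elements : ∀ {n} → Subset n → List (Fin n)
elements []          = []
elements (true ∷ p)  = zero ∷ map suc (elements p)
elements (false ∷ p) = map suc (elements p)

length-elements : ∀ {n} (p : Subset n) → length (elements p) ≡ ∣ p ∣
length-elements []          = refl
length-elements (true ∷ p)  = cong suc (trans (length-map suc (elements p)) (length-elements p))
length-elements (false ∷ p) = trans (length-map suc (elements p)) (length-elements p)

∈-elements⁺ : ∀ {n} {p : Subset n} {x} → x ∈ₛ p → x ∈ elements p
∈-elements⁺ {p = true ∷ p}  here       = here refl
∈-elements⁺ {p = true ∷ p}  (there x∈) = there (∈-map⁺ suc (∈-elements⁺ x∈))
∈-elements⁺ {p = false ∷ p} (there x∈) = ∈-map⁺ suc (∈-elements⁺ x∈)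

∈-elements⁻ : ∀ {n} {p : Subset n} {x} → x ∈ elements p → x ∈ₛ p
∈-elements⁻ {p = true ∷ p} (here refl) = here
∈-elements⁻ {p = true ∷ p} (there x∈) with ∈-map⁻ suc x∈
... | y , y∈ , refl = there (∈-elements⁻ y∈)
∈-elements⁻ {p = false ∷ p} x∈ with ∈-map⁻ suc x∈
... | y , y∈ , refl = there (∈-elements⁻ y∈)

nth : A → List A → ℕ → A
nth d []      _       = d
nth d (x ∷ l) zero    = x
nth d (x ∷ l) (suc k) = nth d l k

nth-∈ : (d : A) (l : List A) (k : ℕ) → k < length l → nth d l k ∈ l
nth-∈ d (x ∷ l) zero    _         = here refl
nth-∈ d (x ∷ l) (suc k) (s≤s k<l) = there (nth-∈ d l k k<l)

∈-nth : (d : A) {l : List A} {x : A} → x ∈ l → ∃ λ k → k < length l × nth d l k ≡ x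
∈-nth d (here refl) = zero , z<s , refl
∈-nth d (there x∈)  = let (k , k<l , eq) = ∈-nth d x∈ in suc k , s≤s k<l , eq

funToFin-cong : ∀ {m n} (f g : Fin m → Fin n) → (∀ i → f i ≡ g i) → funToFin f ≡ funToFin g
funToFin-cong {zero}  f g eq = refl
funToFin-cong {suc m} f g eq = cong₂ combine (eq zero) (funToFin-cong (f ∘ suc) (g ∘ suc) (eq ∘ suc))

-- The host hypergraph formed by accepted links

module LinkGraph (m ρ : ℕ) {Acc : Fin m → Fin (m ^ suc ρ) → Set} (Acc? : ∀ v c → Dec (Acc v c)) where

  edge : Fin m → Fin (m ^ suc ρ) → Subset m
  edge v c = ⁅ v ⁆ ∪ image (finToFun {m} {suc ρ} c) ⊤

  -- The size condition removes pairs whose tuple repeats a vertex or contains `v`.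
  Edge : Subset m → Set
  Edge e = ∣ e ∣ ≡ suc (suc ρ) × ∃ λ v → ∃ λ c → Acc v c × edge v c ≡ e

  Edge? : ∀ e → Dec (Edge e)
  Edge? e = (∣ e ∣ ≟ suc (suc ρ)) ×-dec Fin.any? (λ v → Fin.any? (λ c → Acc? v c ×-dec (edge v c ≟ₛ e)))

  Γ : Hypergraph m
  Γ e = does (Edge? e)

  uniform : Uniform (suc (suc ρ)) Γ
  uniform e = proj₁ ∘ does-true (Edge? e)

  edgeCount-Γ : edgeCount Γ ≤ ∑ (allFin m) (λ v → ∑ (allFin (m ^ suc ρ)) (λ c → 𝟙 (Acc? v c)))
  edgeCount-Γ = begin
    edgeCount Γ                      ≡⟨ countB-∑ Γ (allSubsets m) ⟩
    ∑ (allSubsets m) (𝟙 ∘ Edge?)     ≤⟨ count-cover (allSubsets m) pairs Edge? (λ (v , c) → Acc? v c) (λ (v , c) → edge v c) _≟ₛ_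
                                          (allSubsets-once m)
                                          (λ { e (_ , v , c , a , eq) → (v , c) , ∈-cartesianProduct⁺ (∈-allFin v) (∈-allFin c) , a , eq }) ⟩
    ∑ pairs (λ (v , c) → 𝟙 (Acc? v c))   ≡⟨ ∑-cartesianProduct (allFin m) (allFin (m ^ suc ρ)) _ ⟩
    ∑ (allFin m) (λ v → ∑ (allFin (m ^ suc ρ)) (λ c → 𝟙 (Acc? v c))) ∎
    where
    open ≤-Reasoning
    pairs : List (Fin m × Fin (m ^ suc ρ))
    pairs = cartesianProduct (allFin m) (allFin (m ^ suc ρ))

-- Back links along a degenerate ordering

module BackLinks {n D ρ : ℕ} (H : Hypergraph n) (uniform : Uniform (suc (suc ρ)) H)
  (π : Permutation′ n) (degenerate : ∀ i → backDegree H π i ≤ D) where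

  -- Links name the vertices of `H` by their position in the ordering, so that being earlier becomes
  -- `<` on `Fin n`.
  pos : Fin n → Fin n
  pos x = π ⟨$⟩ˡ x

  Back : Fin n → Subset n → Set
  Back i e = H e ≡ true × (π ⟨$⟩ʳ i) ∈ₛ e × e ⊆ₛ prefixSet π i

  back? : ∀ i e → Dec (Back i e)
  back? i e = (H e Bool.≟ true) ×-dec ((π ⟨$⟩ʳ i) ∈ₛ? e) ×-dec (e ⊆? prefixSet π i)

  -- The default value of nth is never reached on back edges, by link-size.
  tuple : Fin n → Subset n → Fin (suc ρ) → Fin n
  tuple i e k = pos (nth (π ⟨$⟩ʳ i) (elements (e - (π ⟨$⟩ʳ i))) (toℕ k))

  links : Fin n → List (Fin (suc ρ) → Fin n)
  links i = map (tuple i) (filter (back? i) (allSubsets n))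

  links≤D : ∀ i → length (links i) ≤ D
  links≤D i = begin
    length (links i)                            ≡⟨ length-map (tuple i) (filter (back? i) (allSubsets n)) ⟩
    length (filter (back? i) (allSubsets n))    ≡⟨ length-filter-∑ (back? i) (allSubsets n) ⟩
    ∑ (allSubsets n) (𝟙 ∘ back? i)              ≡⟨ ∑-cong (allSubsets n) pointwise ⟩
    ∑ (allSubsets n) (λ e → if H e ∧ _ then 1 else 0)  ≡⟨ sym (countB-∑ _ (allSubsets n)) ⟩
    backDegree H π i                            ≤⟨ degenerate i ⟩
    D                                           ∎
    where
    open ≤-Reasoning
    pointwise : ∀ e → 𝟙 (back? i e) ≡ (if H e ∧ does ((π ⟨$⟩ʳ i) ∈ₛ? e) ∧ does (e ⊆? prefixSet π i) then 1 else 0)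
    pointwise e with H e
    ... | true  = refl
    ... | false = refl

  link-size : ∀ i e → Back i e → length (elements (e - (π ⟨$⟩ʳ i))) ≡ suc ρ
  link-size i e (he , i∈ , _) = trans (length-elements (e - (π ⟨$⟩ʳ i)))
    (suc-injective (trans (sym (∣p∣≡1+∣p-x∣ i∈)) (uniform e he)))

  tuple-∈ : ∀ i e → Back i e → ∀ k → ∃ λ x → x ∈ₛ e - (π ⟨$⟩ʳ i) × tuple i e k ≡ pos x
  tuple-∈ i e back k = _ , ∈-elements⁻ (nth-∈ _ (elements (e - (π ⟨$⟩ʳ i))) (toℕ k)
    (≤-trans (Fin.toℕ<n k) (≤-reflexive (sym (link-size i e back))))) , refl

  ∈-tuple : ∀ i e → Back i e → ∀ x → x ∈ₛ e - (π ⟨$⟩ʳ i) → ∃ λ k → tuple i e k ≡ pos x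
  ∈-tuple i e back x x∈ with ∈-nth (π ⟨$⟩ʳ i) (∈-elements⁺ x∈)
  ... | k , k<l , eq = fromℕ< k<ρ , cong pos (trans (cong (nth _ (elements (e - (π ⟨$⟩ʳ i)))) (Fin.toℕ-fromℕ< k<ρ)) eq)
    where
    k<ρ : k < suc ρ
    k<ρ = ≤-trans k<l (≤-reflexive (link-size i e back))

  prefix-≤ : ∀ i x → x ∈ₛ prefixSet π i → toℕ (pos x) ≤ toℕ i
  prefix-≤ i x x∈ = ≤ᵇ⇒≤ _ _ (Bool.T-≡ .Equivalence.from (trans (sym (lookup∘tabulate _ x)) ([]=⇒lookup x∈)))

  ≤-prefix : ∀ i x → toℕ (pos x) ≤ toℕ i → x ∈ₛ prefixSet π i
  ≤-prefix i x x≤ = lookup⇒[]= x _ (trans (lookup∘tabulate _ x) (Bool.T-≡ .Equivalence.to (≤⇒≤ᵇ x≤)))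

  backward : ∀ i g → g ∈ links i → ∀ k → toℕ (g k) < toℕ i
  backward i g g∈ k with ∈-map⁻ (tuple i) g∈
  ... | e , e∈ , refl = ≤∧≢⇒< (subst (λ z → toℕ z ≤ toℕ i) (sym eq) (prefix-≤ i x (e⊆ (p─q⊆p e _ x∈))))
      (λ same → x∉p-x e (π ⟨$⟩ʳ i) (subst (_∈ₛ e - (π ⟨$⟩ʳ i))
        (trans (sym (inverseʳ π)) (cong (π ⟨$⟩ʳ_) (trans (sym eq) (Fin.toℕ-injective same)))) x∈))
    where
    back : Back i e
    back = proj₂ (∈-filter⁻ (back? i) {xs = allSubsets n} e∈)
    e⊆ = proj₂ (proj₂ back)
    found = tuple-∈ i e back k
    x = proj₁ found
    x∈ = proj₁ (proj₂ found)
    eq = proj₂ (proj₂ found)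

  -- An edge is a back edge of its latest vertex; uniformity makes the edge nonempty.
  last-vertex : ∀ e → H e ≡ true → ∃ λ i → Back i e
  last-vertex e he = pos x , he , subst (_∈ₛ e) (sym (inverseʳ π)) x∈ , λ {y} y∈ → ≤-prefix (pos x) y (proj₂ (proj₂ latest) y y∈)
    where
    nonempty : ∃ λ x → x ∈ₛ e
    nonempty with elements e | length-elements e | (λ {x} → ∈-elements⁻ {p = e} {x})
    ... | []    | len | _    = contradiction (trans len (uniform e he)) λ ()
    ... | x ∷ _ | _   | from = x , from (here refl)
    latest = argmax (_∈ₛ? e) (toℕ ∘ pos) n (λ y _ → <⇒≤ (Fin.toℕ<n (pos y))) nonempty
    x = proj₁ latest
    x∈ = proj₁ (proj₂ latest)

  module _ {m : ℕ} {Acc : Fin m → Fin (m ^ suc ρ) → Set} (Acc? : ∀ v c → Dec (Acc v c))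
    (f : Fin n → Fin m) (f-inj : ∀ x y → f x ≡ f y → x ≡ y)
    (f-acc : ∀ i g → g ∈ links i → Acc (f i) (funToFin (f ∘ g))) where

    open LinkGraph m ρ Acc? using (Γ; edge; Edge?)

    F-inj : Injective _≡_ _≡_ (f ∘ pos)
    F-inj {x} {y} eq = trans (sym (inverseʳ π)) (trans (cong (π ⟨$⟩ʳ_) (f-inj _ _ eq)) (inverseʳ π))

    edge-image : ∀ i e → Back i e → edge (f i) (funToFin (f ∘ tuple i e)) ≡ image (f ∘ pos) e
    edge-image i e back@(_ , i∈ , _) = ⊆-antisym to from
      where
      g : Fin (suc ρ) → Fin n
      g = tuple i e
      u : Fin (suc ρ) → Fin m
      u = finToFun {m} {suc ρ} (funToFin (f ∘ g))
      to : edge (f i) (funToFin (f ∘ g)) ⊆ₛ image (f ∘ pos) e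
      to {z} z∈ with x∈p∪q⁻ ⁅ f i ⁆ _ z∈
      ... | inj₁ z∈ˡ = subst (_∈ₛ image (f ∘ pos) e) (trans (cong f (inverseˡ π)) (sym (x∈⁅y⁆⇒x≡y (f i) z∈ˡ))) (∈-image⁺ (f ∘ pos) e i∈)
      ... | inj₂ z∈ʳ with ∈-image⁻ u ⊤ z∈ʳ
      ...   | k , _ , eq = let (x , x∈ , gk) = tuple-∈ i e back k in
              subst (_∈ₛ image (f ∘ pos) e)
                (trans (cong f (sym gk)) (trans (sym (Fin.finToFun-funToFin (f ∘ g) k)) eq))
                (∈-image⁺ (f ∘ pos) e (p─q⊆p e _ x∈))
      from : image (f ∘ pos) e ⊆ₛ edge (f i) (funToFin (f ∘ g))
      from {z} z∈ with ∈-image⁻ (f ∘ pos) e z∈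
      ... | x , x∈ , refl with x Fin.≟ (π ⟨$⟩ʳ i)
      ...   | yes refl = x∈p∪q⁺ (inj₁ (subst (λ w → f w ∈ₛ ⁅ f i ⁆) (sym (inverseˡ π)) (x∈⁅x⁆ (f i))))
      ...   | no x≢ = let (k , gk) = ∈-tuple i e back x (x∈p∧x≢y⇒x∈p-y x∈ x≢) in
              x∈p∪q⁺ {p = ⁅ f i ⁆} (inj₂ (subst (_∈ₛ image u ⊤)
                (trans (Fin.finToFun-funToFin (f ∘ g) k) (cong f gk))
                (∈-image⁺ u ⊤ {k} ∈⊤)))

    contained : H ⊑ Γ
    contained = f ∘ pos , F-inj , λ e he → let (i , back) = last-vertex e he in
      dec-true (Edge? (image (f ∘ pos) e))
        (trans (∣image∣ (f ∘ pos) F-inj e) (uniform e he) ,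
         f i , funToFin (f ∘ tuple i e) ,
         f-acc i (tuple i e) (∈-map⁺ (tuple i) (∈-filter⁺ (back? i) (∈-allSubsets e) back)) ,
         edge-image i e back)

-- Parameters and edge count

∑-allFin-+ : ∀ a b (f : Fin (a + b) → ℕ) →
  ∑ (allFin (a + b)) f ≡ ∑ (allFin a) (λ i → f (i ↑ˡ b)) + ∑ (allFin b) (λ j → f (a ↑ʳ j))
∑-allFin-+ zero    b f = refl
∑-allFin-+ (suc a) b f = begin
  ∑ (allFin (suc a + b)) f                    ≡⟨ ∑-allFin-suc {a + b} f ⟩
  f zero + ∑ (allFin (a + b)) (f ∘ suc)       ≡⟨ cong (f zero +_) (∑-allFin-+ a b (f ∘ suc)) ⟩
  f zero + (∑ (allFin a) (λ i → f (suc (i ↑ˡ b))) + ∑ (allFin b) (λ j → f (suc (a ↑ʳ j))))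
                                              ≡⟨ sym (+-assoc (f zero) _ _) ⟩
  f zero + ∑ (allFin a) (λ i → f (suc (i ↑ˡ b))) + ∑ (allFin b) (λ j → f (suc (a ↑ʳ j)))
                                              ≡⟨ cong (_+ ∑ (allFin b) (λ j → f (suc (a ↑ʳ j)))) (sym (∑-allFin-suc {a} (λ i → f (i ↑ˡ b)))) ⟩
  ∑ (allFin (suc a)) (λ i → f (i ↑ˡ b)) + ∑ (allFin b) (λ j → f (suc a ↑ʳ j)) ∎
  where open ≡-Reasoning

∑-combine : ∀ m z (f : Fin (m * z) → ℕ) → ∑ (allFin (m * z)) f ≡ ∑ (allFin m) (λ i → ∑ (allFin z) (λ j → f (combine i j)))
∑-combine zero    z f = refl
∑-combine (suc m) z f = trans (∑-allFin-+ z (m * z) f)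
  (trans (cong (∑ (allFin z) (λ j → f (j ↑ˡ (m * z))) +_) (∑-combine m z (λ c → f (z ↑ʳ c))))
         (sym (∑-allFin-suc {m} (λ i → ∑ (allFin z) (λ j → f (combine i j))))))

-- The first entry `finToFun c zero` of a coded tuple is its `quotient` by the number of possible
-- remainders of the tuple, so this sums a function of the first entry over all tuples.
∑-quotient : ∀ m z (h : Fin m → ℕ) → ∑ (allFin (m * z)) (h ∘ quotient z) ≡ z * ∑ (allFin m) h
∑-quotient m z h = begin
  ∑ (allFin (m * z)) (h ∘ quotient z)                                  ≡⟨ ∑-combine m z (h ∘ quotient z) ⟩
  ∑ (allFin m) (λ i → ∑ (allFin z) (λ j → h (quotient z (combine i j))))
    ≡⟨ ∑-cong (allFin m) (λ i → trans (∑-cong (allFin z) (λ j → cong (h ∘ proj₁) (Fin.remQuot-combine {m} {z} i j))) (∑-allFin-const z (h i))) ⟩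
  ∑ (allFin m) (λ i → z * h i)                                         ≡⟨ ∑-*ˡ (allFin m) z h ⟩
  z * ∑ (allFin m) h                                                   ∎
  where open ≡-Reasoning

∑-lookup : (xs : List A) (h : A → ℕ) → ∑ (allFin (length xs)) (h ∘ lookup xs) ≡ ∑ xs h
∑-lookup xs h = trans (sym (∑-tabulate (lookup xs) h)) (cong (λ l → ∑ l h) (tabulate-lookup xs))

∑≤ : ℕ → (ℕ → ℕ) → ℕ
∑≤ zero    g = g 0
∑≤ (suc k) g = g (suc k) + ∑≤ k g

∑≤-cong : ∀ k {g h : ℕ → ℕ} → (∀ e → e ≤ k → g e ≡ h e) → ∑≤ k g ≡ ∑≤ k h
∑≤-cong zero    eq = eq 0 z≤n
∑≤-cong (suc k) eq = cong₂ _+_ (eq (suc k) ≤-refl) (∑≤-cong k (λ e e≤k → eq e (m≤n⇒m≤1+n e≤k)))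

∑≤-*ˡ : ∀ k c (g : ℕ → ℕ) → ∑≤ k (λ e → c * g e) ≡ c * ∑≤ k g
∑≤-*ˡ zero    c g = refl
∑≤-*ˡ (suc k) c g = trans (cong (c * g (suc k) +_) (∑≤-*ˡ k c g)) (sym (*-distribˡ-+ c _ _))

∑≤-const : ∀ k c → ∑≤ k (const c) ≡ suc k * c
∑≤-const zero    c = sym (+-identityʳ c)
∑≤-const (suc k) c = cong (c +_) (∑≤-const k c)

∑≤-geometric : ∀ k p q → 0 < p → ∑≤ k (λ e → 2 ^ (p * e + q)) ≤ 2 * 2 ^ (p * k + q)
∑≤-geometric zero    p q p>0 = m≤m+n _ _
∑≤-geometric (suc k) p q p>0 = begin
  2 ^ (p * suc k + q) + ∑≤ k (λ e → 2 ^ (p * e + q))   ≤⟨ +-monoʳ-≤ (2 ^ (p * suc k + q)) (∑≤-geometric k p q p>0) ⟩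
  2 ^ (p * suc k + q) + 2 ^ (1 + (p * k + q))          ≤⟨ +-monoʳ-≤ (2 ^ (p * suc k + q)) (^-monoʳ-≤ 2 exponent) ⟩
  2 ^ (p * suc k + q) + 2 ^ (p * suc k + q)            ≡⟨ cong (2 ^ (p * suc k + q) +_) (sym (+-identityʳ _)) ⟩
  2 * 2 ^ (p * suc k + q)                              ∎
  where
  open ≤-Reasoning
  exponent : 1 + (p * k + q) ≤ p * suc k + q
  exponent = begin
    1 + (p * k + q)  ≤⟨ +-monoˡ-≤ (p * k + q) p>0 ⟩
    p + (p * k + q)  ≡⟨ sym (+-assoc p _ q) ⟩
    p + p * k + q    ≡⟨ cong (_+ q) (sym (*-suc p k)) ⟩
    p * suc k + q    ∎

levels : (ℕ → ℕ) → ℕ → List ℕ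
levels M zero    = replicate (M 0) 0
levels M (suc k) = replicate (M (suc k)) (suc k) ++ levels M k

∑-levels : ∀ M k (h : ℕ → ℕ) → ∑ (levels M k) h ≡ ∑≤ k (λ e → M e * h e)
∑-levels M zero    h = ∑-replicate (M 0) 0 h
∑-levels M (suc k) h = trans (∑-++ (replicate (M (suc k)) (suc k)) (levels M k) h)
  (cong₂ _+_ (∑-replicate (M (suc k)) (suc k) h) (∑-levels M k h))

levels≤ : ∀ M k → All (_≤ k) (levels M k)
levels≤ M zero    = All.replicate⁺ (M 0) z≤n
levels≤ M (suc k) = All.++⁺ (All.replicate⁺ (M (suc k)) ≤-refl) (All.map m≤n⇒m≤1+n (levels≤ M k))

∑≤-single : ∀ (M : ℕ → ℕ) k e → e ≤ k → ∑≤ k (λ e′ → M e′ * 𝟙 (e′ ≟ e)) ≡ M e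
∑≤-single M zero    zero z≤n = *-identityʳ (M 0)
∑≤-single M (suc k) e e≤ with suc k ≟ e
... | yes refl = trans (cong₂ _+_ (trans (cong (M (suc k) *_) (𝟙-true (suc k ≟ suc k) refl)) (*-identityʳ (M (suc k)))) none) (+-identityʳ _)
  where
  none : ∑≤ k (λ e′ → M e′ * 𝟙 (e′ ≟ suc k)) ≡ 0
  none = trans (∑≤-cong k (λ e′ e′≤k → trans (cong (M e′ *_) (𝟙-false (e′ ≟ suc k) (<⇒≢ (s≤s e′≤k)))) (*-zeroʳ (M e′))))
               (trans (∑≤-const k 0) (*-zeroʳ (suc k)))
... | no k≢e = trans (cong (_+ ∑≤ k (λ e′ → M e′ * 𝟙 (e′ ≟ e))) (trans (cong (M (suc k) *_) (𝟙-false (suc k ≟ e) k≢e)) (*-zeroʳ (M (suc k)))))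
                     (∑≤-single M k e (s≤s⁻¹ (≤∧≢⇒< e≤ (k≢e ∘ sym))))

module Construction (D′ ρ : ℕ) (D′>0 : 0 < D′) where

  -- `c₁` adds the vertices that start at a level and those that fail one level above. `c₂ * w e` is
  -- the size of level `e`: in `2 * c₁ + 3`, one unit pays for the logarithm of the number of
  -- families, `2 * c₁` for `4 ^ N e`, the rest for strictness; the factor 4 comes from `many-hits`.
  -- `C₀` collects the constants of `edgeCount-bound`.
  D r c₁ c₂ C₀ : ℕ
  D  = suc D′
  r  = suc (suc ρ)
  c₁ = D * 2 ^ D * 2 ^ D + D * 2 ^ D
  c₂ = 4 * (2 * c₁ + 3)
  C₀ = 18 * c₂ * c₂ * (2 * c₂) ^ ρ

  module Parameters (n k₀ b ℓ : ℕ)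
    (n≤ : n ≤ 2 ^ D * 2 ^ (D * k₀ + 2 * b)) (b≤k₀ : b ≤ k₀) (1+k₀≤2^b : suc k₀ ≤ 2 ^ b)
    (m≤ : 2 * (c₂ * 2 ^ (D * k₀ + 2 * b)) ≤ 2 ^ ℓ) (ℓ-small : b + 1 + ℓ * (suc ρ * D) ≤ 2 ^ (2 * b))
    where

    w N X M : ℕ → ℕ
    w e = 2 ^ (D * e + 2 * b)
    N e = c₁ * w e
    X e = (2 * c₁ + 3) * w e
    M e = 4 * X e

    W : ℕ
    W = w k₀

    M≡ : ∀ e → M e ≡ c₂ * w e
    M≡ e = sym (*-assoc 4 (2 * c₁ + 3) (w e))

    w>0 : ∀ e → 0 < w e
    w>0 e = m^n>0 2 (D * e + 2 * b)

    levs : List ℕ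
    levs = levels M k₀

    m Z L : ℕ
    m = length levs
    Z = m ^ ρ
    L = m ^ suc ρ

    lev : Fin m → ℕ
    lev = lookup levs

    lev≤k₀ : ∀ v → lev v ≤ k₀
    lev≤k₀ v = All.lookup (levels≤ M k₀) (∈-lookup v)

    ∑-lev : (h : ℕ → ℕ) → ∑ (allFin m) (h ∘ lev) ≡ ∑≤ k₀ (λ e → M e * h e)
    ∑-lev h = trans (∑-lookup levs h) (∑-levels M k₀ h)

    level-size : ∀ e → e ≤ k₀ → ∑ (allFin m) (λ v → 𝟙 (lev v ≟ e)) ≡ M e
    level-size e e≤k₀ = trans (∑-lev (λ e′ → 𝟙 (e′ ≟ e))) (∑≤-single M k₀ e e≤k₀)

    m-bound : m ≤ 2 * (c₂ * W)
    m-bound = begin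
      m                                    ≡⟨ sym (∑-length levs) ⟩
      ∑ levs (const 1)                     ≡⟨ ∑-levels M k₀ (const 1) ⟩
      ∑≤ k₀ (λ e → M e * 1)                ≡⟨ ∑≤-cong k₀ (λ e _ → trans (*-identityʳ (M e)) (M≡ e)) ⟩
      ∑≤ k₀ (λ e → c₂ * w e)               ≡⟨ ∑≤-*ˡ k₀ c₂ w ⟩
      c₂ * ∑≤ k₀ w                         ≤⟨ *-monoʳ-≤ c₂ (∑≤-geometric k₀ D (2 * b) z<s) ⟩
      c₂ * (2 * W)                         ≡⟨ exchange c₂ 2 W ⟩
      2 * (c₂ * W)                         ∎
      where
      open ≤-Reasoning
      exchange : ∀ a b c → a * (b * c) ≡ b * (a * c)
      exchange = solve-∀

    m>0 : 0 < m
    m>0 = n≢0⇒n>0 (λ m≡0 → contradiction (trans (sym (level-size 0 z≤n)) (none m≡0)) (>⇒≢ (*-mono-≤ {1} {4} (s≤s z≤n) (*-mono-≤ {1} {2 * c₁ + 3} (≤-trans (s≤s z≤n) (m≤n+m 3 (2 * c₁))) (w>0 0)))))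
      where
      none : m ≡ 0 → ∑ (allFin m) (λ v → 𝟙 (lev v ≟ 0)) ≡ 0
      none m≡0 = n≤0⇒n≡0 (≤-trans (∑-≤ (allFin m) {c = 1} (λ v _ → 𝟙-≤ (lev v ≟ 0) (λ _ → ≤-refl)))
        (≤-reflexive (trans (*-identityʳ _) (trans (length-tabulate {n = m} id) m≡0))))

    L>0 : 0 < L
    L>0 = m^n>0 m {{>-nonZero m>0}} (suc ρ)

    first : Fin L → Fin m
    first c = finToFun {m} {suc ρ} c zero

    τ t : Fin L → ℕ
    τ c = k₀ ∸ lev (first c)
    t c = D * τ c ∸ b

    K : ℕ → ℕ → ℕ
    K e j = D * e ∸ (D * j ∸ b)

    -- A family is described by `j` and at most `2 ^ (D * e)` sets of `D` links, and a link by
    -- `suc ρ` of at most `2 ^ ℓ` vertices. By `ℓ-small` the logarithm of the number of families is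
    -- at most `w e`.
    union-bound : ∀ e → e ≤ k₀ → (1 + suc k₀ * (L ^ D) ^ (2 ^ (D * e))) * 4 ^ N e < 2 ^ X e
    union-bound e e≤k₀ = begin-strict
      (1 + suc k₀ * (L ^ D) ^ y) * 4 ^ N e        ≤⟨ *-monoˡ-≤ (4 ^ N e) families ⟩
      2 ^ w e * 4 ^ N e                           ≡⟨ cong (2 ^ w e *_) (^-*-assoc 2 2 (N e)) ⟩
      2 ^ w e * 2 ^ (2 * N e)                     ≡⟨ sym (^-distribˡ-+-* 2 (w e) (2 * N e)) ⟩
      2 ^ (w e + 2 * N e)                         <⟨ ^-monoʳ-< 2 ≤-refl exponent ⟩
      2 ^ X e                                     ∎
      where
      open ≤-Reasoning
      y q : ℕ
      y = 2 ^ (D * e)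
      q = suc ρ * D
      exponent : w e + 2 * N e < X e
      exponent = ≤-trans (s≤s (m≤m+n _ (w e))) (≤-trans (+-monoˡ-≤ (w e + 2 * N e + w e) (w>0 e)) (≤-reflexive (collect c₁ (w e))))
        where
        collect : ∀ c w → w + (w + 2 * (c * w) + w) ≡ (2 * c + 3) * w
        collect = solve-∀
      L^D≤ : L ^ D ≤ 2 ^ (ℓ * q)
      L^D≤ = begin
        (m ^ suc ρ) ^ D       ≡⟨ ^-*-assoc m (suc ρ) D ⟩
        m ^ q                 ≤⟨ ^-monoˡ-≤ q (≤-trans m-bound m≤) ⟩
        (2 ^ ℓ) ^ q           ≡⟨ ^-*-assoc 2 ℓ q ⟩
        2 ^ (ℓ * q)           ∎
      y>0 : 0 < y
      y>0 = m^n>0 2 (D * e)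
      families : 1 + suc k₀ * (L ^ D) ^ y ≤ 2 ^ w e
      families = begin
        1 + suc k₀ * (L ^ D) ^ y                  ≤⟨ +-monoʳ-≤ 1 (*-mono-≤ 1+k₀≤2^b (^-monoˡ-≤ y L^D≤)) ⟩
        1 + 2 ^ b * (2 ^ (ℓ * q)) ^ y             ≡⟨ cong (λ z → 1 + 2 ^ b * z) (^-*-assoc 2 (ℓ * q) y) ⟩
        1 + 2 ^ b * 2 ^ (ℓ * q * y)               ≡⟨ cong (1 +_) (sym (^-distribˡ-+-* 2 b (ℓ * q * y))) ⟩
        1 + 2 ^ (b + ℓ * q * y)                   ≤⟨ +-monoˡ-≤ _ (m^n>0 2 (b + ℓ * q * y)) ⟩
        2 ^ (b + ℓ * q * y) + 2 ^ (b + ℓ * q * y) ≡⟨ cong (2 ^ (b + ℓ * q * y) +_) (sym (+-identityʳ _)) ⟩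
        2 ^ suc (b + ℓ * q * y)                   ≤⟨ ^-monoʳ-≤ 2 (begin
          suc (b + ℓ * q * y)                       ≡⟨ cong (_+ ℓ * q * y) (+-comm 1 b) ⟩
          b + 1 + ℓ * q * y                         ≤⟨ +-monoˡ-≤ (ℓ * q * y) (m≤m*n (b + 1) y {{>-nonZero y>0}}) ⟩
          (b + 1) * y + ℓ * q * y                   ≡⟨ sym (*-distribʳ-+ y (b + 1) (ℓ * q)) ⟩
          (b + 1 + ℓ * q) * y                       ≤⟨ *-monoˡ-≤ y ℓ-small ⟩
          2 ^ (2 * b) * y                           ≡⟨ trans (*-comm (2 ^ (2 * b)) y) (sym (^-distribˡ-+-* 2 (D * e) (2 * b))) ⟩
          w e                                       ∎) ⟩
        2 ^ w e                                   ∎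

    open Host D k₀ m L L>0 lev lev≤k₀ t K (λ e j → m∸n≤m (D * e) (D * j ∸ b)) N X level-size union-bound
      using (Acc; Acc?; capped-accepts; cost-bound; hits; weight)

    open LinkGraph m ρ Acc? using (Γ; edgeCount-Γ) renaming (uniform to Γ-uniform)

    universal : Universal r D n Γ
    universal H H-uniform (π , degenerate) = from-embedding embedding
      where
      open BackLinks {D = D} H H-uniform π degenerate
      -- Here `D ≥ 2` enters: `D * k₀` is `k₀` plus `D′ * k₀`, and the latter is at least `b`.
      k₀≤ : k₀ ≤ D * k₀ ∸ b
      k₀≤ = m+n≤o⇒m≤o∸n k₀ (+-monoʳ-≤ k₀ (≤-trans b≤k₀ (m≤n*m k₀ D′ {{>-nonZero D′>0}})))
      open Embedding D k₀ b n m L ρ z<s k₀≤ 1+k₀≤2^b lev lev≤k₀ first funToFin funToFin-cong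
        (λ u → Fin.finToFun-funToFin u zero) links links≤D backward using (starts; starts-bound; module Online)
      n≤N : n ≤ N k₀
      n≤N = ≤-trans n≤ (*-monoˡ-≤ W (≤-trans (m≤n*m (2 ^ D) D) (m≤n+m (D * 2 ^ D) (D * 2 ^ D * 2 ^ D))))
      N-recursion : ∀ e → e < k₀ → starts e + 2 ^ b * (D * 2 ^ (b + D * suc e)) ≤ N e
      N-recursion e e<k₀ = begin
        starts e + 2 ^ b * (D * 2 ^ (b + D * suc e))     ≤⟨ +-mono-≤ first-part (≤-reflexive second-part) ⟩
        D * 2 ^ D * 2 ^ D * w e + D * 2 ^ D * w e        ≡⟨ sym (*-distribʳ-+ (w e) (D * 2 ^ D * 2 ^ D) (D * 2 ^ D)) ⟩
        N e                                              ∎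
        where
        open ≤-Reasoning
        gap : ℕ
        gap = k₀ ∸ suc e
        W≡ : W ≡ 2 ^ (D * gap) * (2 ^ D * w e)
        W≡ = sym (trans (cong (2 ^ (D * gap) *_) (sym (^-distribˡ-+-* 2 D (D * e + 2 * b))))
          (trans (sym (^-distribˡ-+-* 2 (D * gap) (D + (D * e + 2 * b))))
            (cong (2 ^_) (trans (regroup D gap e b) (cong (λ z → D * z + 2 * b) (m∸n+n≡m e<k₀))))))
          where
          regroup : ∀ D g e b → D * g + (D + (D * e + 2 * b)) ≡ D * (g + suc e) + 2 * b
          regroup = solve-∀
        first-part : starts e ≤ D * 2 ^ D * 2 ^ D * w e
        first-part = *-cancelʳ-≤ (starts e) (D * 2 ^ D * 2 ^ D * w e) (2 ^ (D * gap)) {{m^n≢0 2 (D * gap)}} (begin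
          starts e * 2 ^ (D * gap)                           ≤⟨ starts-bound e e<k₀ ⟩
          D * n                                              ≤⟨ *-monoʳ-≤ D n≤ ⟩
          D * (2 ^ D * W)                                    ≡⟨ cong (λ z → D * (2 ^ D * z)) W≡ ⟩
          D * (2 ^ D * (2 ^ (D * gap) * (2 ^ D * w e)))      ≡⟨ regroup D (2 ^ D) (2 ^ (D * gap)) (w e) ⟩
          D * 2 ^ D * 2 ^ D * w e * 2 ^ (D * gap)            ∎)
          where
          regroup : ∀ d x g w → d * (x * (g * (x * w))) ≡ d * x * x * w * g
          regroup = solve-∀
        second-part : 2 ^ b * (D * 2 ^ (b + D * suc e)) ≡ D * 2 ^ D * w e
        second-part = trans (regroup₁ (2 ^ b) D _) (trans (cong (D *_) (trans (sym (^-distribˡ-+-* 2 b (b + D * suc e)))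
          (trans (cong (2 ^_) (regroup₂ D b e)) (^-distribˡ-+-* 2 D (D * e + 2 * b))))) (sym (*-assoc D (2 ^ D) (w e))))
          where
          regroup₁ : ∀ a d c → a * (d * c) ≡ d * (a * c)
          regroup₁ = solve-∀
          regroup₂ : ∀ D b e → b + (b + D * suc e) ≡ D + (D * e + 2 * b)
          regroup₂ = solve-∀
      N<M : ∀ e → N e < M e
      N<M e = ≤-trans (+-monoˡ-≤ (N e) (w>0 e)) (≤-trans (m≤m+n _ _) (≤-reflexive (collect c₁ (w e))))
        where
        collect : ∀ c w → w + c * w + (7 * (c * w) + 11 * w) ≡ 4 * ((2 * c + 3) * w)
        collect = solve-∀
      open Online Acc? capped-accepts N M N<M (λ e e≤k₀ → ≤-reflexive (sym (level-size e e≤k₀))) hits n≤N N-recursion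
      from-embedding : (∃ λ (f : Fin n → Fin m) → (∀ x y → f x ≡ f y → x ≡ y) ×
                        (∀ i g → g ∈ links i → Acc (f i) (funToFin (f ∘ g)))) → H ⊑ Γ
      from-embedding (f , f-inj , f-acc) = contained Acc? f f-inj f-acc

    -- Each of the `k₀ + 1` levels contributes the same `c₂ * W`, because level size and
    -- `2 ^ (D * τ)` vary inversely, and the shift by `b` in `t` makes up for their number. Where
    -- `D * τ < b` the shift is cut off at 0, which costs the extra `m * 2 ^ b`.
    weight-bound : weight ≤ Z * (3 * (c₂ * W))
    weight-bound = *-cancelˡ-≤ (2 ^ b) {{m^n≢0 2 b}} (begin
      2 ^ b * weight                                                   ≡⟨ sym (∑-*ˡ (allFin L) (2 ^ b) _) ⟩
      ∑ (allFin L) (λ c → 2 ^ b * 2 ^ t c)                        ≤⟨ ∑-mono (allFin L) (λ c → split (D * τ c)) ⟩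
      ∑ (allFin L) (h ∘ first)                                    ≡⟨ ∑-quotient m Z h ⟩
      Z * ∑ (allFin m) h                                          ≡⟨ cong (Z *_) (∑-+ (allFin m) (const (2 ^ b)) (λ v → 2 ^ (D * (k₀ ∸ lev v)))) ⟩
      Z * (∑ (allFin m) (const (2 ^ b)) + ∑ (allFin m) (λ v → 2 ^ (D * (k₀ ∸ lev v))))
        ≡⟨ cong₂ (λ u v → Z * (u + v)) (∑-allFin-const m (2 ^ b)) (trans (∑-lev (λ e → 2 ^ (D * (k₀ ∸ e)))) (trans (∑≤-cong k₀ level-weight) (∑≤-const k₀ (c₂ * W)))) ⟩
      Z * (m * 2 ^ b + suc k₀ * (c₂ * W))                         ≤⟨ *-monoʳ-≤ Z (+-mono-≤ (*-monoˡ-≤ (2 ^ b) m-bound) (*-monoˡ-≤ (c₂ * W) 1+k₀≤2^b)) ⟩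
      Z * (2 * (c₂ * W) * 2 ^ b + 2 ^ b * (c₂ * W))               ≡⟨ collect Z (c₂ * W) (2 ^ b) ⟩
      2 ^ b * (Z * (3 * (c₂ * W)))                                ∎)
      where
      open ≤-Reasoning
      h : Fin m → ℕ
      h v = 2 ^ b + 2 ^ (D * (k₀ ∸ lev v))
      split : ∀ d → 2 ^ b * 2 ^ (d ∸ b) ≤ 2 ^ b + 2 ^ d
      split d with b ≤? d
      ... | yes b≤d = ≤-trans (≤-reflexive (trans (sym (^-distribˡ-+-* 2 b (d ∸ b))) (cong (2 ^_) (m+[n∸m]≡n b≤d)))) (m≤n+m _ _)
      ... | no b≰d  = ≤-trans (≤-reflexive (trans (cong (λ z → 2 ^ b * 2 ^ z) (m≤n⇒m∸n≡0 (<⇒≤ (≰⇒> b≰d)))) (*-identityʳ (2 ^ b)))) (m≤m+n (2 ^ b) _)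
      level-weight : ∀ e → e ≤ k₀ → M e * 2 ^ (D * (k₀ ∸ e)) ≡ c₂ * W
      level-weight e e≤k₀ = trans (cong (_* 2 ^ (D * (k₀ ∸ e))) (M≡ e)) (trans (*-assoc c₂ (w e) _) (cong (c₂ *_)
        (trans (sym (^-distribˡ-+-* 2 (D * e + 2 * b) (D * (k₀ ∸ e)))) (cong (2 ^_) (trans (regroup D e (k₀ ∸ e) b)
          (cong (λ z → D * z + 2 * b) (m+[n∸m]≡n e≤k₀)))))))
        where
        regroup : ∀ D e g b → D * e + 2 * b + D * g ≡ D * (e + g) + 2 * b
        regroup = solve-∀
      collect : ∀ z x y → z * (2 * x * y + y * x) ≡ y * (z * (3 * x))
      collect = solve-∀

    -- A vertex of level `e` accepts at most `3 * weight / 2 ^ e` tuples. Since `D′ > 0`, the level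
    -- sizes divided by `2 ^ e` still grow geometrically, so the top level dominates and no factor
    -- `k₀` is lost.
    edgeCount-bound : 2 ^ k₀ * edgeCount Γ ≤ C₀ * W ^ r
    edgeCount-bound = begin
      2 ^ k₀ * edgeCount Γ                                  ≤⟨ *-monoʳ-≤ (2 ^ k₀) edgeCount-Γ ⟩
      2 ^ k₀ * ∑ (allFin m) degree                          ≡⟨ sym (∑-*ˡ (allFin m) (2 ^ k₀) degree) ⟩
      ∑ (allFin m) (λ v → 2 ^ k₀ * degree v)                ≤⟨ ∑-mono (allFin m) scaled ⟩
      ∑ (allFin m) (λ v → 2 ^ (k₀ ∸ lev v) * (3 * weight))       ≡⟨ ∑-*ʳ (allFin m) (λ v → 2 ^ (k₀ ∸ lev v)) (3 * weight) ⟩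
      ∑ (allFin m) (λ v → 2 ^ (k₀ ∸ lev v)) * (3 * weight)       ≡⟨ cong (_* (3 * weight)) (∑-lev (λ e → 2 ^ (k₀ ∸ e))) ⟩
      ∑≤ k₀ (λ e → M e * 2 ^ (k₀ ∸ e)) * (3 * weight)            ≡⟨ cong (_* (3 * weight)) (trans (∑≤-cong k₀ level-weight) (∑≤-*ˡ k₀ c₂ _)) ⟩
      c₂ * ∑≤ k₀ (λ e → 2 ^ (D′ * e + (k₀ + 2 * b))) * (3 * weight)
                                                            ≤⟨ *-mono-≤ (*-monoʳ-≤ c₂ (∑≤-geometric k₀ D′ (k₀ + 2 * b) D′>0)) (*-monoʳ-≤ 3 weight-bound) ⟩
      c₂ * (2 * 2 ^ (D′ * k₀ + (k₀ + 2 * b))) * (3 * (Z * (3 * (c₂ * W))))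
                                                            ≡⟨ cong (λ z → c₂ * (2 * 2 ^ z) * (3 * (Z * (3 * (c₂ * W))))) (merge D′ k₀ b) ⟩
      c₂ * (2 * W) * (3 * (Z * (3 * (c₂ * W))))             ≤⟨ *-monoʳ-≤ (c₂ * (2 * W)) (*-monoʳ-≤ 3 (*-monoˡ-≤ (3 * (c₂ * W)) (^-monoˡ-≤ ρ m-bound))) ⟩
      c₂ * (2 * W) * (3 * ((2 * (c₂ * W)) ^ ρ * (3 * (c₂ * W))))
                                                            ≡⟨ cong (λ z → c₂ * (2 * W) * (3 * (z * (3 * (c₂ * W))))) power ⟩
      c₂ * (2 * W) * (3 * ((2 * c₂) ^ ρ * W ^ ρ * (3 * (c₂ * W))))
                                                            ≡⟨ collect c₂ W ((2 * c₂) ^ ρ) (W ^ ρ) ⟩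
      C₀ * W ^ r                                            ∎
      where
      open ≤-Reasoning
      degree : Fin m → ℕ
      degree v = ∑ (allFin L) (λ c → 𝟙 (Acc? v c))
      scaled : ∀ v → 2 ^ k₀ * degree v ≤ 2 ^ (k₀ ∸ lev v) * (3 * weight)
      scaled v = ≤-trans (≤-reflexive (trans (cong (λ z → 2 ^ z * degree v) (sym (m∸n+n≡m (lev≤k₀ v))))
        (trans (cong (_* degree v) (^-distribˡ-+-* 2 (k₀ ∸ lev v) (lev v))) (*-assoc (2 ^ (k₀ ∸ lev v)) (2 ^ lev v) (degree v)))))
        (*-monoʳ-≤ (2 ^ (k₀ ∸ lev v)) (cost-bound v))
      level-weight : ∀ e → e ≤ k₀ → M e * 2 ^ (k₀ ∸ e) ≡ c₂ * 2 ^ (D′ * e + (k₀ + 2 * b))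
      level-weight e e≤k₀ = trans (cong (_* 2 ^ (k₀ ∸ e)) (M≡ e)) (trans (*-assoc c₂ (w e) _) (cong (c₂ *_)
        (trans (sym (^-distribˡ-+-* 2 (D * e + 2 * b) (k₀ ∸ e))) (cong (2 ^_) (trans (regroup D′ e (k₀ ∸ e) b)
          (cong (λ z → D′ * e + (z + 2 * b)) (m+[n∸m]≡n e≤k₀)))))))
        where
        regroup : ∀ D′ e g b → suc D′ * e + 2 * b + g ≡ D′ * e + (e + g + 2 * b)
        regroup = solve-∀
      merge : ∀ D′ k b → D′ * k + (k + 2 * b) ≡ suc D′ * k + 2 * b
      merge = solve-∀
      power : (2 * (c₂ * W)) ^ ρ ≡ (2 * c₂) ^ ρ * W ^ ρ
      power = trans (cong (_^ ρ) (sym (*-assoc 2 c₂ W))) (^-distribʳ-* ρ (2 * c₂) W)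
      collect : ∀ c w x y → c * (2 * w) * (3 * (x * y * (3 * (c * w)))) ≡ 18 * c * c * x * (w * (w * y))
      collect = solve-∀

    universal-hypergraph : Σ ℕ λ m → Σ (Hypergraph m) λ Γ →
      Uniform r Γ × Universal r D n Γ × 2 ^ k₀ * edgeCount Γ ≤ C₀ * W ^ r
    universal-hypergraph = m , Γ , Γ-uniform , universal , edgeCount-bound

-- Asymptotics

1≤⌈log₂⌉ : ∀ {n} → 2 ≤ n → 1 ≤ ⌈log₂ n ⌉
1≤⌈log₂⌉ 2≤n = ≤-trans (≤-reflexive (sym (⌈log₂2^n⌉≡n 1))) (⌈log₂⌉-mono-≤ 2≤n)

n≤2^⌈log₂n⌉ : ∀ n → n ≤ 2 ^ ⌈log₂ n ⌉
n≤2^⌈log₂n⌉ = <-rec _ step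
  where
  open ≤-Reasoning
  step : ∀ n → (∀ {k} → k < n → k ≤ 2 ^ ⌈log₂ k ⌉) → n ≤ 2 ^ ⌈log₂ n ⌉
  step 0 _ = z≤n
  step 1 _ = m^n>0 2 ⌈log₂ 1 ⌉
  step n@(suc (suc k)) ih = begin
    n                                   ≡⟨ sym (⌊n/2⌋+⌈n/2⌉≡n n) ⟩
    ⌊ n /2⌋ + ⌈ n /2⌉                   ≤⟨ +-monoˡ-≤ ⌈ n /2⌉ (⌊n/2⌋≤⌈n/2⌉ n) ⟩
    ⌈ n /2⌉ + ⌈ n /2⌉                   ≡⟨ cong (⌈ n /2⌉ +_) (sym (+-identityʳ ⌈ n /2⌉)) ⟩
    2 * ⌈ n /2⌉                         ≤⟨ *-monoʳ-≤ 2 (ih (⌈n/2⌉<n k)) ⟩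
    2 * 2 ^ ⌈log₂ ⌈ n /2⌉ ⌉             ≡⟨ cong (λ z → 2 ^ suc z) (⌈log₂⌈n/2⌉⌉≡⌈log₂n⌉∸1 n) ⟩
    2 ^ suc (⌈log₂ n ⌉ ∸ 1)             ≡⟨ cong (2 ^_) (m+[n∸m]≡n (1≤⌈log₂⌉ {n} (s≤s (s≤s z≤n)))) ⟩
    2 ^ ⌈log₂ n ⌉                       ∎

2^[⌈log₂n⌉∸1]<n : ∀ n → 2 ≤ n → 2 ^ (⌈log₂ n ⌉ ∸ 1) < n
2^[⌈log₂n⌉∸1]<n n 2≤n = ≰⇒> λ n≤ → <⇒≱ (≤-reflexive (m+[n∸m]≡n (1≤⌈log₂⌉ 2≤n)))
  (≤-trans (⌈log₂⌉-mono-≤ n≤) (≤-reflexive (⌈log₂2^n⌉≡n (⌈log₂ n ⌉ ∸ 1))))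

n<2^n : ∀ n → suc n ≤ 2 ^ n
n<2^n zero    = ≤-refl
n<2^n (suc n) = ≤-trans (+-mono-≤ (m^n>0 2 n) (n<2^n n)) (≤-reflexive (cong (2 ^ n +_) (sym (+-identityʳ (2 ^ n)))))

-- With `x = suc (3 * a + d)` this is `a x ≤ 2 ^ (x − 1)` for `x > 3 a`. It starts from
-- `(a + 1) ^ 3 ≤ 2 ^ (3 a)`, and each step at most doubles the left side.
linear≤exponential : ∀ a d → a * suc (3 * a + d) ≤ 2 ^ (3 * a + d)
linear≤exponential a zero = begin
  a * suc (3 * a + 0)                                  ≤⟨ m≤m+n _ (a * (a * a) + 2 * a + 1) ⟩
  a * suc (3 * a + 0) + (a * (a * a) + 2 * a + 1)      ≡⟨ cube a ⟩
  suc a * (suc a * suc a)                              ≤⟨ *-mono-≤ (n<2^n a) (*-mono-≤ (n<2^n a) (n<2^n a)) ⟩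
  2 ^ a * (2 ^ a * 2 ^ a)                              ≡⟨ cong (2 ^ a *_) (sym (^-distribˡ-+-* 2 a a)) ⟩
  2 ^ a * 2 ^ (a + a)                                  ≡⟨ sym (^-distribˡ-+-* 2 a (a + a)) ⟩
  2 ^ (a + (a + a))                                    ≡⟨ cong (2 ^_) (triple a) ⟩
  2 ^ (3 * a + 0)                                      ∎
  where
  open ≤-Reasoning
  cube : ∀ a → a * suc (3 * a + 0) + (a * (a * a) + 2 * a + 1) ≡ suc a * (suc a * suc a)
  cube = solve-∀
  triple : ∀ a → a + (a + a) ≡ 3 * a + 0
  triple = solve-∀
linear≤exponential a (suc d) = begin
  a * suc (3 * a + suc d)             ≤⟨ m≤m+n _ (a * (3 * a + d)) ⟩
  a * suc (3 * a + suc d) + a * (3 * a + d)   ≡⟨ double a d ⟩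
  2 * (a * suc (3 * a + d))           ≤⟨ *-monoʳ-≤ 2 (linear≤exponential a d) ⟩
  2 ^ suc (3 * a + d)                 ≡⟨ cong (2 ^_) (sym (+-suc (3 * a) d)) ⟩
  2 ^ (3 * a + suc d)                 ∎
  where
  open ≤-Reasoning
  double : ∀ a d → a * suc (3 * a + suc d) + a * (3 * a + d) ≡ 2 * (a * suc (3 * a + d))
  double = solve-∀

module Asymptotics (D′ ρ : ℕ) (D′>0 : 0 < D′) where

  open Construction D′ ρ D′>0

  -- `b ≤ k₀` follows from `a * b < ƛ`, and this from `linear≤exponential` when `b > 3 a`. A set of
  -- `D` links has `q` entries, and `c₄ ≤ 2 ^ b` gives `ℓ-small`. `threshold` secures both.
  a q c₄ threshold : ℕ
  a  = D + 2
  q  = suc ρ * D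
  c₄ = 1 + (2 * c₂ + 1) * q
  threshold = 2 ^ (2 ^ suc (3 * a) + c₄)

  module Large (n : ℕ) (n-large : threshold ≤ n) where

    -- The `1` in `T` ensures `W ≤ 2 ^ (ƛ − 1) < n`; together with the rounding in `k₀` it costs at
    -- most a factor `2 ^ D`, hence `n≤`.
    ƛ b T k₀ : ℕ
    ƛ  = ⌈log₂ n ⌉
    b  = ⌈log₂ ƛ ⌉
    T  = ƛ ∸ (1 + 2 * b)
    k₀ = T / D

    ƛ-large : 2 ^ suc (3 * a) + c₄ ≤ ƛ
    ƛ-large = ≤-trans (≤-reflexive (sym (⌈log₂2^n⌉≡n (2 ^ suc (3 * a) + c₄)))) (⌈log₂⌉-mono-≤ n-large)

    2≤ƛ : 2 ≤ ƛ
    2≤ƛ = ≤-trans (≤-trans (*-monoʳ-≤ 2 (m^n>0 2 (3 * a))) (m≤m+n _ c₄)) ƛ-large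

    2≤n : 2 ≤ n
    2≤n = ≤-trans (^-monoʳ-≤ 2 {1} (≤-trans (m^n>0 2 (suc (3 * a))) (m≤m+n _ c₄))) n-large

    1≤b : 1 ≤ b
    1≤b = 1≤⌈log₂⌉ 2≤ƛ

    b-large : suc (3 * a) ≤ b
    b-large = ≤-trans (≤-reflexive (sym (⌈log₂2^n⌉≡n (suc (3 * a))))) (⌈log₂⌉-mono-≤ (≤-trans (m≤m+n _ c₄) ƛ-large))

    ab<ƛ : a * b < ƛ
    ab<ƛ = ≤-<-trans (begin
      a * b                                     ≡⟨ cong (a *_) (sym b≡) ⟩
      a * suc (3 * a + d)                       ≤⟨ linear≤exponential a d ⟩
      2 ^ (3 * a + d)                           ≡⟨ cong (λ z → 2 ^ (z ∸ 1)) b≡ ⟩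
      2 ^ (b ∸ 1)                               ∎) (2^[⌈log₂n⌉∸1]<n ƛ 2≤ƛ)
      where
      open ≤-Reasoning
      d : ℕ
      d = b ∸ suc (3 * a)
      b≡ : suc (3 * a + d) ≡ b
      b≡ = m+[n∸m]≡n b-large

    T+1+2b≡ƛ : T + (1 + 2 * b) ≡ ƛ
    T+1+2b≡ƛ = m∸n+n≡m (≤-trans (s≤s (*-monoˡ-≤ b (m≤n+m 2 D))) ab<ƛ)

    b≤k₀ : b ≤ k₀
    b≤k₀ = ≤-trans (≤-reflexive (sym (m*n/n≡m b D))) (/-monoˡ-≤ D (m+n≤o⇒m≤o∸n (b * D) (≤-trans (≤-reflexive (regroup b D)) ab<ƛ)))
      where
      regroup : ∀ b D → b * D + (1 + 2 * b) ≡ suc ((D + 2) * b)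
      regroup = solve-∀

    exponent-lower : D * k₀ + 2 * b ≤ ƛ ∸ 1
    exponent-lower = begin
      D * k₀ + 2 * b    ≤⟨ +-monoˡ-≤ (2 * b) (≤-trans (≤-reflexive (*-comm D k₀)) (m/n*n≤m T D)) ⟩
      T + 2 * b         ≡⟨ cong (_∸ 1) (trans (sym (+-suc T (2 * b))) T+1+2b≡ƛ) ⟩
      ƛ ∸ 1             ∎
      where open ≤-Reasoning

    exponent-upper : ƛ ≤ D + (D * k₀ + 2 * b)
    exponent-upper = begin
      ƛ                                   ≡⟨ sym T+1+2b≡ƛ ⟩
      T + (1 + 2 * b)                     ≡⟨ cong (_+ (1 + 2 * b)) (m≡m%n+[m/n]*n T D) ⟩
      T % D + k₀ * D + (1 + 2 * b)        ≡⟨ regroup (T % D) k₀ D b ⟩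
      suc (T % D) + (D * k₀ + 2 * b)      ≤⟨ +-monoˡ-≤ (D * k₀ + 2 * b) (m%n<n T D) ⟩
      D + (D * k₀ + 2 * b)                ∎
      where
      open ≤-Reasoning
      regroup : ∀ t k D b → t + k * D + (1 + 2 * b) ≡ suc t + (D * k + 2 * b)
      regroup = solve-∀

    W : ℕ
    W = 2 ^ (D * k₀ + 2 * b)

    W≤n : W ≤ n
    W≤n = ≤-trans (^-monoʳ-≤ 2 exponent-lower) (<⇒≤ (2^[⌈log₂n⌉∸1]<n n 2≤n))

    n≤ : n ≤ 2 ^ D * W
    n≤ = ≤-trans (n≤2^⌈log₂n⌉ n) (≤-trans (^-monoʳ-≤ 2 exponent-upper) (≤-reflexive (^-distribˡ-+-* 2 D (D * k₀ + 2 * b))))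

    ƛ≤2^b : ƛ ≤ 2 ^ b
    ƛ≤2^b = n≤2^⌈log₂n⌉ ƛ

    1+k₀≤2^b : suc k₀ ≤ 2 ^ b
    1+k₀≤2^b = begin
      suc k₀            ≤⟨ s≤s (m/n≤m T D) ⟩
      suc T             ≤⟨ m≤m+n (suc T) (2 * b) ⟩
      suc T + 2 * b     ≡⟨ trans (sym (+-suc T (2 * b))) T+1+2b≡ƛ ⟩
      ƛ                 ≤⟨ ƛ≤2^b ⟩
      2 ^ b             ∎
      where open ≤-Reasoning

    ℓ : ℕ
    ℓ = 2 * c₂ + ƛ

    m≤ : 2 * (c₂ * W) ≤ 2 ^ ℓ
    m≤ = begin
      2 * (c₂ * W)               ≡⟨ sym (*-assoc 2 c₂ W) ⟩
      2 * c₂ * W                 ≤⟨ *-mono-≤ (≤-trans (n≤1+n (2 * c₂)) (n<2^n (2 * c₂))) (≤-trans W≤n (n≤2^⌈log₂n⌉ n)) ⟩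
      2 ^ (2 * c₂) * 2 ^ ƛ       ≡⟨ sym (^-distribˡ-+-* 2 (2 * c₂) ƛ) ⟩
      2 ^ ℓ                      ∎
      where open ≤-Reasoning

    ℓ-small : b + 1 + ℓ * q ≤ 2 ^ (2 * b)
    ℓ-small = begin
      b + 1 + (2 * c₂ + ƛ) * q           ≤⟨ +-mono-≤ (≤-trans (≤-reflexive (+-comm b 1)) (n<2^n b))
                                              (*-monoˡ-≤ q (+-mono-≤ (m≤m*n (2 * c₂) y {{m^n≢0 2 b}}) ƛ≤2^b)) ⟩
      y + (2 * c₂ * y + y) * q           ≡⟨ collect y (2 * c₂) q ⟩
      (1 + (2 * c₂ + 1) * q) * y         ≤⟨ *-monoˡ-≤ y (≤-trans (≤-trans (m≤n+m c₄ _) ƛ-large) ƛ≤2^b) ⟩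
      y * y                              ≡⟨ sym (^-distribˡ-+-* 2 b b) ⟩
      2 ^ (b + b)                        ≡⟨ cong (λ z → 2 ^ (b + z)) (sym (+-identityʳ b)) ⟩
      2 ^ (2 * b)                        ∎
      where
      open ≤-Reasoning
      y : ℕ
      y = 2 ^ b
      collect : ∀ y c q → y + (c * y + y) * q ≡ (1 + (c + 1) * q) * y
      collect = solve-∀

    open Parameters n k₀ b ℓ n≤ b≤k₀ 1+k₀≤2^b m≤ ℓ-small using (universal-hypergraph)

    2^2b≤ : 2 ^ (2 * b) ≤ 4 * ƛ ^ 2
    2^2b≤ = begin
      2 ^ (2 * b)          ≡⟨ cong (2 ^_) (*-comm 2 b) ⟩
      2 ^ (b * 2)          ≡⟨ sym (^-*-assoc 2 b 2) ⟩
      (2 ^ b) ^ 2          ≡⟨ cong (λ z → (2 ^ z) ^ 2) (sym (m+[n∸m]≡n 1≤b)) ⟩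
      (2 * 2 ^ (b ∸ 1)) ^ 2  ≤⟨ ^-monoˡ-≤ 2 (*-monoʳ-≤ 2 (<⇒≤ (2^[⌈log₂n⌉∸1]<n ƛ 2≤ƛ))) ⟩
      (2 * ƛ) ^ 2          ≡⟨ ^-distribʳ-* 2 2 ƛ ⟩
      4 * ƛ ^ 2            ∎
      where open ≤-Reasoning

    final-bound : ∀ E → 2 ^ k₀ * E ≤ C₀ * W ^ r →
      E ^ D ≤ (4 * C₀) ^ D * n ^ (r * D ∸ 1) * ƛ ^ 2 * b ^ (D * (2 * r + 1))
    final-bound E bound = begin
      E ^ D                                              ≤⟨ *-cancelˡ-≤ (2 ^ (D * k₀)) {{m^n≢0 2 (D * k₀)}} scaled ⟩
      C₀ ^ D * (W ^ s * 2 ^ (2 * b))                     ≤⟨ *-monoʳ-≤ (C₀ ^ D) (*-mono-≤ (^-monoˡ-≤ s W≤n) 2^2b≤) ⟩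
      C₀ ^ D * (n ^ s * (4 * ƛ ^ 2))                     ≡⟨ regroup (C₀ ^ D) (n ^ s) 4 (ƛ ^ 2) ⟩
      4 * C₀ ^ D * n ^ s * ƛ ^ 2                         ≤⟨ *-monoˡ-≤ (ƛ ^ 2) (*-monoˡ-≤ (n ^ s) (*-monoˡ-≤ (C₀ ^ D) (^-monoʳ-≤ 4 {1} {D} (s≤s z≤n)))) ⟩
      4 ^ D * C₀ ^ D * n ^ s * ƛ ^ 2                     ≡⟨ cong (λ z → z * n ^ s * ƛ ^ 2) (sym (^-distribʳ-* D 4 C₀)) ⟩
      (4 * C₀) ^ D * n ^ s * ƛ ^ 2                       ≤⟨ m≤m*n _ (b ^ (D * (2 * r + 1))) {{m^n≢0 b (D * (2 * r + 1)) {{>-nonZero 1≤b}}}} ⟩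
      (4 * C₀) ^ D * n ^ s * ƛ ^ 2 * b ^ (D * (2 * r + 1)) ∎
      where
      open ≤-Reasoning
      s : ℕ
      s = r * D ∸ 1
      regroup : ∀ c x y z → c * (x * (y * z)) ≡ y * c * x * z
      regroup = solve-∀
      W≡ : W ≡ 2 ^ (D * k₀) * 2 ^ (2 * b)
      W≡ = ^-distribˡ-+-* 2 (D * k₀) (2 * b)
      scaled : 2 ^ (D * k₀) * E ^ D ≤ 2 ^ (D * k₀) * (C₀ ^ D * (W ^ s * 2 ^ (2 * b)))
      scaled = begin
        2 ^ (D * k₀) * E ^ D           ≡⟨ cong (_* E ^ D) (trans (cong (2 ^_) (*-comm D k₀)) (sym (^-*-assoc 2 k₀ D))) ⟩
        (2 ^ k₀) ^ D * E ^ D           ≡⟨ sym (^-distribʳ-* D (2 ^ k₀) E) ⟩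
        (2 ^ k₀ * E) ^ D               ≤⟨ ^-monoˡ-≤ D bound ⟩
        (C₀ * W ^ r) ^ D               ≡⟨ ^-distribʳ-* D C₀ (W ^ r) ⟩
        C₀ ^ D * (W ^ r) ^ D           ≡⟨ cong (C₀ ^ D *_) (^-*-assoc W r D) ⟩
        -- `r` and `D` are successors, so `W ^ (r * D)` unfolds to `W * W ^ s`; the split-off `W`
        -- supplies the `2 ^ (D * k₀)` to be cancelled.
        C₀ ^ D * W ^ (r * D)           ≡⟨⟩
        C₀ ^ D * (W * W ^ s)           ≡⟨ cong (λ z → C₀ ^ D * (z * W ^ s)) W≡ ⟩
        C₀ ^ D * (2 ^ (D * k₀) * 2 ^ (2 * b) * W ^ s)   ≡⟨ pull (C₀ ^ D) (2 ^ (D * k₀)) (2 ^ (2 * b)) (W ^ s) ⟩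
        2 ^ (D * k₀) * (C₀ ^ D * (W ^ s * 2 ^ (2 * b))) ∎
        where
        pull : ∀ c x y z → c * (x * y * z) ≡ x * (c * (z * y))
        pull = solve-∀

    result : Σ ℕ λ m → Σ (Hypergraph m) λ Γ → Uniform r Γ × Universal r D n Γ ×
      (edgeCount Γ ^ D ≤ (4 * C₀) ^ D * n ^ (r * D ∸ 1) * ƛ ^ 2 * b ^ (D * (2 * r + 1)))
    result = let (m , Γ , uni , univ , bound) = universal-hypergraph in
      m , Γ , uni , univ , final-bound (edgeCount Γ) bound

theorem1 : (D r : ℕ) → 2 ≤ D → 2 ≤ r →
    Σ ℕ λ C → Σ ℕ λ N → (n : ℕ) → N ≤ n →
    Σ ℕ λ m → Σ (Hypergraph m) λ Γ →
    Uniform r Γ × Universal r D n Γ ×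
    (edgeCount Γ ^ D ≤
    (C ^ D) * (n ^ (r * D ∸ 1)) * (⌈log₂ n ⌉ ^ 2) * (⌈log₂ ⌈log₂ n ⌉ ⌉ ^ (D * (2 * r + 1))))
theorem1 (suc D′) (suc (suc ρ)) (s≤s D′>0) (s≤s (s≤s _)) = 4 * C₀ , threshold , λ n large → Large.result n large
  where
  open Construction D′ ρ D′>0
  open Asymptotics D′ ρ D′>0
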